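{- Let $f(x)=\dfrac{1+x}{\cos x}=\sum_{k\ge0}a_kx^k/k!$, so that $a_{2k}=E_{2k}$ and $a_{2k+1}=(2k+1)E_{2k}$, where the $E_{2k}$ are the secant numbers. Then for all $n\ge 1$, $$\ddot H_n(f)=\det(a_{2i+j})_{0\le i,j\le n-1}=2^{\binom n2}\,\bigl((n-1)!!\bigr)^2\prod_{k=1}^{n-2}(k!!)^6.$$
   Context: The secant numbers are defined by $1/\cos x=\sum_{k\ge0}E_{2k}x^{2k}/(2k)!$. Conventions: $m!!=m(m-2)(m-4)\cdots$ down to $1$ or $2$, with $0!!=(-1)!!=1$; empty products equal $1$. -}

module Defs where

open import Algebra.Bundles using (CommutativeRing)
open import Data.Empty using (⊥)
open import Data.Fin.Base using (Fin; zero; suc; toℕ; punchIn)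
open import Data.Integer.Base as ℤ using (+_; -1ℤ)
open import Data.List.Base using (map; upTo)
open import Data.Nat.Base as ℕ using (ℕ; zero; suc; _∸_; _!)
open import Data.Nat.ListAction using (product)
import Data.Nat.Properties as ℕₚ
open import Data.Rational.Base
open import Data.Rational.Properties
import Data.Rational.Unnormalised.Base as ℚᵘ
import Data.Rational.Unnormalised.Properties as ℚᵘ
open import Data.Sum.Base using (_⊎_; inj₁; inj₂)
open import Data.Unit.Base using (⊤)
open import Data.Vec.Functional using (Vector; []; _∷_)
open import Function.Base using (_∘_)
open import Relation.Binary.PropositionalEquality

open import Algebra.Properties.Semiring.Sum
  (CommutativeRing.semiring +-*-commutativeRing) public
  using (sum; sum-cong-≗; sum-replicate-zero; sum-syntax; sum⁺-syntax)

fromℕ : ℕ → ℚ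
fromℕ m = + m / 1

sign : ℕ → ℚ
sign k = (-1ℤ ℤ.^ k) / 1

infix 9 _!!

_!! : ℕ → ℕ
0 !!           = 1
1 !!           = 1
suc (suc m) !! = suc (suc m) ℕ.* m !!

-- Laplace expansion along row 0.
det : ∀ n → (Fin n → Fin n → ℚ) → ℚ
det zero    M = 1ℚ
det (suc n) M = ∑[ j < suc n ]
  (sign (toℕ j) * M zero j * det n (λ i k → M (suc i) (punchIn j k)))

-- Formal power series over ℚ, as ordinary coefficient sequences:
-- f k is the coefficient of x^k.
FPS : Set
FPS = ℕ → ℚ

infixl 7 _⊛_

_⊛_ : FPS → FPS → FPS
(f ⊛ g) n = ∑[ i ≤ n ] (f (toℕ i) * g (n ∸ toℕ i))

1S : FPS
1S zero    = 1ℚ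
1S (suc _) = 0ℚ

1+X : FPS
1+X 0             = 1ℚ
1+X 1             = 1ℚ
1+X (suc (suc _)) = 0ℚ

-- The first n coefficients of 1/g in reverse order, from the recurrence
-- b_n = ([n = 0] - Σ_{1≤i≤n} g_i b_{n-i}) / g_0.
recipRev : (g : FPS) .{{_ : NonZero (g 0)}} → ∀ n → Vector ℚ n
recipRev g zero    = []
recipRev g (suc n) =
  ((1S n - ∑[ i < n ] (g (suc (toℕ i)) * recipRev g n i)) ÷ g 0)
  ∷ recipRev g n

recip : (g : FPS) .{{_ : NonZero (g 0)}} → FPS
recip g n = recipRev g (suc n) zero

-- Σ_k s_k x^k / k!
egf : (ℕ → ℚ) → FPS
egf s k = s k * ((+ 1 / (k !)) {{k ℕₚ.!≢0}})

-- The sequence s with f = Σ_k s_k x^k / k!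
egfCoeff : FPS → ℕ → ℚ
egfCoeff f k = fromℕ (k !) * f k

-- s_0, 0, s_1, 0, s_2, 0, …
evens : (ℕ → ℚ) → ℕ → ℚ
evens s 0             = s 0
evens s 1             = 0ℚ
evens s (suc (suc n)) = evens (s ∘ suc) n

cosine : FPS
cosine = egf (evens sign)

secant : FPS
secant = recip cosine

-- The subscript is the exponent of x, so the secant numbers are E 0, E 2,
-- E 4, …; secant≗ below says that 1/cos x = Σ_k E_{2k} x^{2k} / (2k)!.
E : ℕ → ℚ
E = egfCoeff secant

f : FPS
f = 1+X ⊛ secant

a : ℕ → ℚ
a = egfCoeff f

Ḧ : ℕ → FPS → ℚ
Ḧ n g = det n (λ i j → egfCoeff g (2 ℕ.* toℕ i ℕ.+ toℕ j))

-- ∏_{k=1}^m g k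
∏₁ : ℕ → (ℕ → ℕ) → ℕ
∏₁ m g = product (map (g ∘ suc) (upTo m))

recipRev-lookup : (g : FPS) .{{_ : NonZero (g 0)}} → ∀ n (i : Fin n) →
                  recipRev g n i ≡ recip g (n ∸ suc (toℕ i))
recipRev-lookup g (suc n) zero    = refl
recipRev-lookup g (suc n) (suc i) = recipRev-lookup g n i

⊛-recip : (g : FPS) .{{_ : NonZero (g 0)}} → g ⊛ recip g ≗ 1S
⊛-recip g n = begin
  g 0 * recip g n + ∑[ i < n ] (g (suc (toℕ i)) * recip g (n ∸ suc (toℕ i)))
    ≡⟨ cong₂ _+_ head≡
         (sum-cong-≗ (λ i → cong (g (suc (toℕ i)) *_) (sym (recipRev-lookup g n i)))) ⟩
  (1S n - S) + S    ≡⟨ +-assoc (1S n) (- S) S ⟩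
  1S n + (- S + S)  ≡⟨ cong (_+_ (1S n)) (+-inverseˡ S) ⟩
  1S n + 0ℚ         ≡⟨ +-identityʳ (1S n) ⟩
  1S n              ∎
  where
  open ≡-Reasoning
  S = ∑[ i < n ] (g (suc (toℕ i)) * recipRev g n i)
  head≡ : g 0 * recip g n ≡ 1S n - S
  head≡ = begin
    g 0 * ((1S n - S) * 1/ g 0)  ≡⟨ *-comm (g 0) _ ⟩
    (1S n - S) * 1/ g 0 * g 0    ≡⟨ *-assoc (1S n - S) (1/ g 0) (g 0) ⟩
    (1S n - S) * (1/ g 0 * g 0)  ≡⟨ cong ((1S n - S) *_) (*-inverseˡ (g 0)) ⟩
    (1S n - S) * 1ℚ              ≡⟨ *-identityʳ (1S n - S) ⟩
    1S n - S                     ∎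

fromℕ-inverse : ∀ m .{{_ : ℕ.NonZero m}} → fromℕ m * (+ 1 / m) ≡ 1ℚ
fromℕ-inverse (suc m) = toℚᵘ-injective
  (ℚᵘ.≃-trans (toℚᵘ-homo-* (fromℕ (suc m)) (+ 1 / suc m))
  (ℚᵘ.≃-trans (ℚᵘ.*-cong (toℚᵘ-fromℚᵘ (ℚᵘ.mkℚᵘ (+ suc m) 0))
                         (toℚᵘ-fromℚᵘ (ℚᵘ.mkℚᵘ (+ 1) m)))
              (ℚᵘ.*≡* (cong (+_ ∘ suc) (begin
    m ℕ.* 1 ℕ.* 1    ≡⟨ ℕₚ.*-identityʳ (m ℕ.* 1) ⟩
    m ℕ.* 1          ≡⟨ ℕₚ.*-identityʳ m ⟩
    m                ≡⟨ ℕₚ.+-identityʳ m ⟨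
    m ℕ.+ 0          ≡⟨ ℕₚ.+-identityʳ (m ℕ.+ 0) ⟨
    m ℕ.+ 0 ℕ.+ 0    ∎)))))
  where open ≡-Reasoning

egf-egfCoeff : ∀ g → egf (egfCoeff g) ≗ g
egf-egfCoeff g k = begin
  fromℕ (k !) * g k * r    ≡⟨ cong (_* r) (*-comm (fromℕ (k !)) (g k)) ⟩
  g k * fromℕ (k !) * r    ≡⟨ *-assoc (g k) (fromℕ (k !)) r ⟩
  g k * (fromℕ (k !) * r)  ≡⟨ cong (g k *_) (fromℕ-inverse (k !) {{k ℕₚ.!≢0}}) ⟩
  g k * 1ℚ                 ≡⟨ *-identityʳ (g k) ⟩
  g k                      ∎
  where
  open ≡-Reasoning
  r = (+ 1 / (k !)) {{k ℕₚ.!≢0}}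

private
  Odd : ℕ → Set
  Odd 0             = ⊥
  Odd 1             = ⊤
  Odd (suc (suc n)) = Odd n

  odd-split : ∀ n (i : Fin n) → Odd n →
              Odd (suc (toℕ i)) ⊎ Odd (n ∸ suc (toℕ i))
  odd-split n             zero          o = inj₁ _
  odd-split (suc (suc n)) (suc zero)    o = inj₂ o
  odd-split (suc (suc n)) (suc (suc i)) o = odd-split n i o

  evens-odd : ∀ s n → Odd n → evens s n ≡ 0ℚ
  evens-odd s 1             o = refl
  evens-odd s (suc (suc n)) o = evens-odd (s ∘ suc) n o

  evens-cong : ∀ {s t} → s ≗ t → evens s ≗ evens t
  evens-cong e 0             = e 0
  evens-cong e 1             = refl
  evens-cong e (suc (suc n)) = evens-cong (e ∘ suc) n

  evens-of-even : ∀ s → (∀ n → Odd n → s n ≡ 0ℚ) →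
                  evens (λ k → s (2 ℕ.* k)) ≗ s
  evens-of-even s z 0             = refl
  evens-of-even s z 1             = sym (z 1 _)
  evens-of-even s z (suc (suc n)) =
    trans (evens-cong (λ k → cong s (ℕₚ.*-suc 2 k)) n)
          (evens-of-even (λ m → s (suc (suc m))) (λ m → z (suc (suc m))) n)

  1S-odd : ∀ n → Odd n → 1S n ≡ 0ℚ
  1S-odd (suc n) o = refl

  recipRev-odd : (g : FPS) .{{_ : NonZero (g 0)}} → (∀ n → Odd n → g n ≡ 0ℚ) →
                 ∀ n (i : Fin n) → Odd (n ∸ suc (toℕ i)) → recipRev g n i ≡ 0ℚ
  recipRev-odd g z (suc n) (suc i) o = recipRev-odd g z n i o
  recipRev-odd g z (suc n) zero    o =
    trans (cong₂ (λ p S → (p - S) * 1/ g 0) (1S-odd n o) S≡0) (*-zeroˡ (1/ g 0))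
    where
    term : ∀ i → g (suc (toℕ i)) * recipRev g n i ≡ 0ℚ
    term i with odd-split n i o
    ... | inj₁ p = trans (cong (_* recipRev g n i) (z (suc (toℕ i)) p))
                         (*-zeroˡ (recipRev g n i))
    ... | inj₂ p = trans (cong (g (suc (toℕ i)) *_) (recipRev-odd g z n i p))
                         (*-zeroʳ (g (suc (toℕ i))))
    S≡0 = trans (sum-cong-≗ term) (sum-replicate-zero n)

secant≗ : secant ≗ egf (evens (λ k → E (2 ℕ.* k)))
secant≗ n = begin
  secant n                           ≡⟨ egf-egfCoeff secant n ⟨
  egf E n                            ≡⟨ cong (_* ((+ 1 / (n !)) {{n ℕₚ.!≢0}})) (evens-of-even E E-odd n) ⟨
  egf (evens (λ k → E (2 ℕ.* k))) n  ∎
  where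
  open ≡-Reasoning
  cosine-odd : ∀ m → Odd m → cosine m ≡ 0ℚ
  cosine-odd m o = trans (cong (_* ((+ 1 / (m !)) {{m ℕₚ.!≢0}})) (evens-odd sign m o))
                         (*-zeroˡ ((+ 1 / (m !)) {{m ℕₚ.!≢0}}))
  E-odd : ∀ m → Odd m → E m ≡ 0ℚ
  E-odd m o = trans (cong (fromℕ (m !) *_) (recipRev-odd cosine cosine-odd (suc m) zero o))
                    (*-zeroʳ (fromℕ (m !)))

{-# OPTIONS --safe #-}

-- Put s = sin x. Then f = (1 + arcsin s) / √(1 - s²) = Σ_m c_m s^m / m! with
-- c_m = ((m-1)!!)². Since (d/dx)² s^m/m! = s^(m-2)/(m-2)! - m² s^m/m! and
-- c_(m+2) = (m+1)² c_m, we get (d/dx)^(2i) f = Σ_m c_m p_i(m) s^m/m!, where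
-- p_0 = 1 and p_(i+1)(m) = (m+1)² p_i(m+2) - m² p_i(m) is a polynomial of
-- degree i+1 whose (i+1)-st difference is 2^(i+1) ((i+1)!)². Newton's formula
-- p_i(m) = Σ_k (m C k) Δ^k p_i(0) therefore writes (a_(2i+j)) as L U with
-- L_ik = Δ^k p_i(0) lower triangular, and U upper triangular with diagonal c_k
-- because s^m = O(x^m).

module Submission where

open import Defs
open import Algebra.Bundles using (CommutativeRing)
open import Data.Fin.Base using (Fin; zero; suc; toℕ; punchIn; punchOut; inject₁; fromℕ<)
import Data.Fin.Properties as Fin
open import Data.Integer.Base as ℤ using (-1ℤ; -[1+_])
import Data.Integer.Properties as ℤ
open import Data.List.Base using (map; upTo; []; _∷_; _++_)
import Data.List.Properties as List
open import Data.Nat.Base as ℕ using (ℕ; zero; suc; z≤n; s≤s; _∸_; _≥_; _^_; _!)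
open import Data.Nat.Combinatorics using (_C_; nCn≡1; nC1≡n; nCk+nC[k+1]≡[n+1]C[k+1])
open import Data.Nat.Combinatorics.Specification using (k>n⇒nCk≡0)
open import Data.Nat.ListAction using (product)
open import Data.Nat.ListAction.Properties using (product-++)
import Data.Nat.Properties as ℕ
import Data.Nat.Solver as ℕ
open import Data.Product.Base using (_×_; _,_; ∃)
open import Data.Rational.Base hiding (_≥_)
open import Data.Rational.Properties
open import Data.Rational.Solver using (module +-*-Solver)
import Data.Rational.Unnormalised.Base as ℚᵘ
import Data.Rational.Unnormalised.Properties as ℚᵘ
open import Data.Sum.Base using (_⊎_; inj₁; inj₂)
open import Data.Vec.Functional using (Vector; updateAt)
open import Data.Vec.Functional.Properties using (updateAt-updates; updateAt-minimal)
open import Function.Base using (_∘_; const)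
open import Relation.Binary.Definitions using (tri<; tri≈; tri>)
open import Relation.Binary.PropositionalEquality
open import Relation.Nullary using (yes; no; contradiction)
open import Algebra.Properties.Semiring.Sum (CommutativeRing.semiring +-*-commutativeRing)
  using (∑-distrib-+; *-distribˡ-sum; ∑-comm)

-- The shape of the closed form comes from the pivots 2^k (k!)² c_k. Since k! = k!! (k-1)!!, pivot k
-- equals 2^k (k!!)² ((k-1)!!)^4. So k!! occurs twice in pivot k and four times in pivot k+1, which
-- gives sixth powers for k ≤ n-2 and leaves a square at k = n-1.
--
-- The recurrence of the c_m reflects that g(s) = (1 + arcsin s)/√(1-s²) satisfies (1-s²) g' = 1 + s
-- g. No inverse sine, square root or composition of series is formed, however: f is characterised
-- by cos x · f = 1 + x, which has one solution because cos 0 = 1, and Σ c_m s^m/m! is checked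
-- against this equation, the derivative of its product with cos x telescoping to 1. As that sum is
-- infinite, the computation is done on truncations with explicit error terms that do not reach the
-- coefficients in question.
--
-- The determinant is given by Laplace expansion along a row, so the passage from L U to the pivots
-- uses linearity and alternation in the columns, turning L U into L one column at a time.

-- Double factorials and the closed form

m<n⇒n≡m+suc[n∸suc[m]] : ∀ {m n} → m ℕ.< n → n ≡ m ℕ.+ suc (n ∸ suc m)
m<n⇒n≡m+suc[n∸suc[m]] {m} m<n = trans (sym (ℕ.m+[n∸m]≡n m<n)) (sym (ℕ.+-suc m _))

2*suc[m]+n≡2*m+[2+n] : ∀ m n → 2 ℕ.* suc m ℕ.+ n ≡ 2 ℕ.* m ℕ.+ (2 ℕ.+ n)
2*suc[m]+n≡2*m+[2+n] = solve 2 (λ m n →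
  con 2 :* (con 1 :+ m) :+ n := con 2 :* m :+ (con 2 :+ n)) refl
  where open ℕ.+-*-Solver

2*k*k*[p*[y*y]]≡2*p*[k*y*[k*y]] : ∀ k p y →
  2 ℕ.* k ℕ.* k ℕ.* (p ℕ.* (y ℕ.* y)) ≡ 2 ℕ.* p ℕ.* (k ℕ.* y ℕ.* (k ℕ.* y))
2*k*k*[p*[y*y]]≡2*p*[k*y*[k*y]] = solve 3 (λ k p y →
  con 2 :* k :* k :* (p :* (y :* y)) := con 2 :* p :* (k :* y :* (k :* y))) refl
  where open ℕ.+-*-Solver

-- Truncated subtraction reads (-1)!! as `0 !!`, which is its conventional value 1; so the
-- recurrence, and `c-step` with it, starts at m = 0.
!!-suc : ∀ m → suc m !! ≡ suc m ℕ.* (m ∸ 1) !!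
!!-suc zero    = refl
!!-suc (suc m) = refl

!≡!!*!! : ∀ m → suc m ! ≡ suc m !! ℕ.* m !!
!≡!!*!! zero    = refl
!≡!!*!! (suc m) = begin
  (2 ℕ.+ m) ℕ.* suc m !             ≡⟨ cong ((2 ℕ.+ m) ℕ.*_) (trans (!≡!!*!! m) (ℕ.*-comm (suc m !!) (m !!))) ⟩
  (2 ℕ.+ m) ℕ.* (m !! ℕ.* suc m !!) ≡⟨ ℕ.*-assoc (2 ℕ.+ m) (m !!) (suc m !!) ⟨
  (2 ℕ.+ m) !! ℕ.* suc m !!         ∎
  where open ≡-Reasoning

∏₁-last : ∀ m g → ∏₁ (suc m) g ≡ ∏₁ m g ℕ.* g (suc m)
∏₁-last m g = begin
  product (map (g ∘ suc) (upTo (suc m)))            ≡⟨ cong (product ∘ map (g ∘ suc)) (List.upTo-∷ʳ m) ⟨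
  product (map (g ∘ suc) (upTo m ++ (m ∷ [])))      ≡⟨ cong product (List.map-++ (g ∘ suc) (upTo m) (m ∷ [])) ⟩
  product (map (g ∘ suc) (upTo m) ++ (g (suc m) ∷ []))
                                                    ≡⟨ product-++ (map (g ∘ suc) (upTo m)) (g (suc m) ∷ []) ⟩
  ∏₁ m g ℕ.* (g (suc m) ℕ.* 1)                      ≡⟨ cong (∏₁ m g ℕ.*_) (ℕ.*-identityʳ (g (suc m))) ⟩
  ∏₁ m g ℕ.* g (suc m)                              ∎
  where open ≡-Reasoning

-- The induction step from n = m + 1 to n = m + 2, where the extra factor is the pivot with index m
-- + 1. Of the six factors m!!, two stand in the old value, two come from ((m+1)!)² through
-- `!≡!!*!!`, and two are `c (suc m)`; the power of 2 grows by Pascal's rule.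
closed-form-step : ∀ m →
  2 ^ (suc m C 2) ℕ.* (m !!) ^ 2 ℕ.* ∏₁ (m ∸ 1) (λ k → (k !!) ^ 6)
    ℕ.* (2 ^ suc m ℕ.* (suc m ! ℕ.* suc m !) ℕ.* (m !! ℕ.* m !!)) ≡
  2 ^ ((2 ℕ.+ m) C 2) ℕ.* (suc m !!) ^ 2 ℕ.* ∏₁ m (λ k → (k !!) ^ 6)
closed-form-step m = begin
  p ℕ.* y ^ 2 ℕ.* r ℕ.* (q ℕ.* (suc m ! ℕ.* suc m !) ℕ.* (y ℕ.* y))
    ≡⟨ cong (λ z → p ℕ.* y ^ 2 ℕ.* r ℕ.* (q ℕ.* (z ℕ.* z) ℕ.* (y ℕ.* y))) (!≡!!*!! m) ⟩
  p ℕ.* y ^ 2 ℕ.* r ℕ.* (q ℕ.* (x ℕ.* y ℕ.* (x ℕ.* y)) ℕ.* (y ℕ.* y))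
    ≡⟨ solve 5 (λ p q r x y →
         p :* (y :* (y :* con 1)) :* r :* (q :* (x :* y :* (x :* y)) :* (y :* y))
         := q :* p :* (x :* (x :* con 1)) :* (r :* (y :* (y :* (y :* (y :* (y :* (y :* con 1))))))))
         refl p q r x y ⟩
  q ℕ.* p ℕ.* x ^ 2 ℕ.* (r ℕ.* y ^ 6)
    ≡⟨ cong₂ (λ s t → s ℕ.* x ^ 2 ℕ.* t) power (∏₁-pred m) ⟨
  2 ^ ((2 ℕ.+ m) C 2) ℕ.* x ^ 2 ℕ.* ∏₁ m (λ k → (k !!) ^ 6) ∎
  where
  open ≡-Reasoning
  open ℕ.+-*-Solver
  p = 2 ^ (suc m C 2)
  q = 2 ^ suc m
  r = ∏₁ (m ∸ 1) (λ k → (k !!) ^ 6)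
  x = suc m !!
  y = m !!
  power : 2 ^ ((2 ℕ.+ m) C 2) ≡ q ℕ.* p
  power = trans
    (cong (2 ^_) (trans (sym (nCk+nC[k+1]≡[n+1]C[k+1] (suc m) 1))
                        (cong (ℕ._+ suc m C 2) (nC1≡n (suc m)))))
    (ℕ.^-distribˡ-+-* 2 (suc m) (suc m C 2))
  ∏₁-pred : ∀ m → ∏₁ m (λ k → (k !!) ^ 6) ≡ ∏₁ (m ∸ 1) (λ k → (k !!) ^ 6) ℕ.* (m !!) ^ 6
  -- Both products are empty here, and the additional factor is `(0 !!) ^ 6` = 1.
  ∏₁-pred zero    = refl
  ∏₁-pred (suc m) = ∏₁-last m (λ k → (k !!) ^ 6)

open +-*-Solver

-- Determinants

sum-zero : ∀ {n} {g : Vector ℚ n} → (∀ i → g i ≡ 0ℚ) → sum g ≡ 0ℚ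
sum-zero {n} g≡0 = trans (sum-cong-≗ g≡0) (sum-replicate-zero n)

Matrix : ℕ → Set
Matrix n = Fin n → Fin n → ℚ

minor : ∀ {n} → Matrix (suc n) → Fin (suc n) → Matrix n
minor M j i k = M (suc i) (punchIn j k)

cofactor : ∀ {n} → Matrix (suc n) → Fin (suc n) → ℚ
cofactor {n} M j = sign (toℕ j) * M zero j * det n (minor M j)

det-cong : ∀ n {M N : Matrix n} → (∀ i j → M i j ≡ N i j) → det n M ≡ det n N
det-cong zero    M≡N = refl
det-cong (suc n) M≡N = sum-cong-≗ λ j →
  cong₂ (λ x y → sign (toℕ j) * x * y) (M≡N zero j)
        (det-cong n λ i k → M≡N (suc i) (punchIn j k))

-- In the Laplace term for column j, either j = c and linearity sits in the entry of row 0 while the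
-- minor avoids column c, or it sits in the minor, where c has become `punchOut j≢c`. The three
-- matrices are compared entrywise so that the induction applies to minors directly.
det-linear : ∀ n (c : Fin n) s t {M A B : Matrix n} →
             (∀ i → M i c ≡ s * A i c + t * B i c) →
             (∀ i j → j ≢ c → M i j ≡ A i j) →
             (∀ i j → j ≢ c → M i j ≡ B i j) →
             det n M ≡ s * det n A + t * det n B
det-linear (suc n) c s t {M} {A} {B} at-c M≡A M≡B = begin
  sum (cofactor M)
    ≡⟨ sum-cong-≗ cofactor-linear ⟩
  sum (λ j → s * cofactor A j + t * cofactor B j)
    ≡⟨ ∑-distrib-+ (λ j → s * cofactor A j) (λ j → t * cofactor B j) ⟩
  sum (λ j → s * cofactor A j) + sum (λ j → t * cofactor B j)
    ≡⟨ cong₂ _+_ (*-distribˡ-sum s (cofactor A)) (*-distribˡ-sum t (cofactor B)) ⟨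
  s * sum (cofactor A) + t * sum (cofactor B) ∎
  where
  open ≡-Reasoning
  cofactor-linear : ∀ j → cofactor M j ≡ s * cofactor A j + t * cofactor B j
  cofactor-linear j with j Fin.≟ c
  ... | yes refl = trans
          (cong (λ x → sign (toℕ j) * x * det n (minor M j)) (at-c zero))
          (trans (solve 6 (λ e s t x y d →
                    e :* (s :* x :+ t :* y) :* d := s :* (e :* x :* d) :+ t :* (e :* y :* d))
                    refl (sign (toℕ j)) s t (A zero j) (B zero j) (det n (minor M j)))
                 (cong₂ (λ p q → s * (sign (toℕ j) * A zero j * p) + t * (sign (toℕ j) * B zero j * q))
                    (det-cong n λ i k → M≡A (suc i) (punchIn j k) (Fin.punchInᵢ≢i j k))
                    (det-cong n λ i k → M≡B (suc i) (punchIn j k) (Fin.punchInᵢ≢i j k))))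
  ... | no j≢c = trans
          (cong (sign (toℕ j) * M zero j *_) minor-linear)
          (trans (solve 6 (λ e m s t p q →
                    e :* m :* (s :* p :+ t :* q) := s :* (e :* m :* p) :+ t :* (e :* m :* q))
                    refl (sign (toℕ j)) (M zero j) s t (det n (minor A j)) (det n (minor B j)))
                 (cong₂ (λ p q → s * (sign (toℕ j) * p * det n (minor A j))
                               + t * (sign (toℕ j) * q * det n (minor B j)))
                    (M≡A zero j j≢c) (M≡B zero j j≢c)))
    where
    c′ = punchOut j≢c
    c′↦c : punchIn j c′ ≡ c
    c′↦c = Fin.punchIn-punchOut j≢c
    off : ∀ k → k ≢ c′ → punchIn j k ≢ c
    off k k≢c′ eq = k≢c′ (Fin.punchIn-injective j k c′ (trans eq (sym c′↦c)))
    minor-linear : det n (minor M j) ≡ s * det n (minor A j) + t * det n (minor B j)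
    minor-linear = det-linear n c′ s t
      (λ i → subst (λ d → M (suc i) d ≡ s * A (suc i) d + t * B (suc i) d) (sym c′↦c) (at-c (suc i)))
      (λ i k k≢c′ → M≡A (suc i) (punchIn j k) (off k k≢c′))
      (λ i k k≢c′ → M≡B (suc i) (punchIn j k) (off k k≢c′))

sum-adjacent : ∀ {n} (c : Fin n) (g : Vector ℚ (suc n)) →
               (∀ j → j ≢ inject₁ c → j ≢ suc c → g j ≡ 0ℚ) →
               sum g ≡ g (inject₁ c) + g (suc c)
sum-adjacent {suc n} zero g z = trans
  (cong (λ r → g zero + (g (suc zero) + r))
        (sum-zero λ j → z (suc (suc j)) (λ ()) (λ ())))
  (cong (g zero +_) (+-identityʳ (g (suc zero))))
sum-adjacent {suc n} (suc c) g z = trans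
  (cong₂ _+_ (z zero (λ ()) (λ ()))
     (sum-adjacent c (g ∘ suc) λ j p q →
        z (suc j) (p ∘ Fin.suc-injective) (q ∘ Fin.suc-injective)))
  (+-identityˡ _)

sign-suc : ∀ k → sign (suc k) ≡ - sign k
sign-suc k = trans (cong (_/ 1) (ℤ.-1*i≡-i (-1ℤ ℤ.^ k))) (/1-neg (-1ℤ ℤ.^ k))
  where
  /1-neg : ∀ z → (ℤ.- z) / 1 ≡ - (z / 1)
  /1-neg (ℤ.+ zero)  = refl
  /1-neg (ℤ.+ suc n) = refl
  /1-neg -[1+ n ]   = solve 1 (λ x → x := :- (:- x)) refl ((ℤ.+ suc n) / 1)

-- Makes the two minors in `det-adjacent` coincide: in the second case each minor keeps the other
-- column of the equal pair, in the same position.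
punchIn-adjacent : ∀ {n} (c k : Fin n) →
  punchIn (inject₁ c) k ≡ punchIn (suc c) k ⊎
  (punchIn (inject₁ c) k ≡ suc c × punchIn (suc c) k ≡ inject₁ c)
punchIn-adjacent zero    zero    = inj₂ (refl , refl)
punchIn-adjacent zero    (suc k) = inj₁ refl
punchIn-adjacent (suc c) zero    = inj₁ refl
punchIn-adjacent (suc c) (suc k) with punchIn-adjacent c k
... | inj₁ p       = inj₁ (cong suc p)
... | inj₂ (p , q) = inj₂ (cong suc p , cong suc q)

punchIn-adjacent⁻ : ∀ {n} (c : Fin (suc n)) (j : Fin (suc (suc n))) →
  j ≢ inject₁ c → j ≢ suc c →
  ∃ λ c′ → punchIn j (inject₁ c′) ≡ inject₁ c × punchIn j (suc c′) ≡ suc c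
punchIn-adjacent⁻ zero zero p q = contradiction refl p
punchIn-adjacent⁻ zero (suc zero) p q = contradiction refl q
punchIn-adjacent⁻ {suc n} zero (suc (suc j)) p q = zero , refl , refl
punchIn-adjacent⁻ (suc c) zero p q = c , refl , refl
punchIn-adjacent⁻ {suc n} (suc c) (suc j) p q
  with punchIn-adjacent⁻ c j (p ∘ cong suc) (q ∘ cong suc)
... | c′ , e , e′ = suc c′ , cong suc e , cong suc e′

-- Laplace terms that delete neither column have a minor in which the pair is still adjacent, so
-- they vanish by induction; the two terms that delete one of the pair have equal minors and
-- opposite signs.
det-adjacent : ∀ n (c : Fin n) (M : Matrix (suc n)) →
               (∀ i → M i (inject₁ c) ≡ M i (suc c)) → det (suc n) M ≡ 0ℚ
det-adjacent (suc n) c M equal = begin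
  sum (cofactor M)                              ≡⟨ sum-adjacent c (cofactor M) vanish ⟩
  cofactor M (inject₁ c) + cofactor M (suc c)   ≡⟨ cong (_+ cofactor M (suc c)) first ⟩
  e * m * d + cofactor M (suc c)                ≡⟨ cong (λ s → e * m * d + s * m * d) (sign-suc (toℕ c)) ⟩
  e * m * d + (- e) * m * d                     ≡⟨ solve 3 (λ e m d → e :* m :* d :+ (:- e) :* m :* d := con 0ℚ) refl e m d ⟩
  0ℚ                                            ∎
  where
  open ≡-Reasoning
  e = sign (toℕ c)
  m = M zero (suc c)
  d = det (suc n) (minor M (suc c))
  same-minor : ∀ i k → minor M (inject₁ c) i k ≡ minor M (suc c) i k
  same-minor i k with punchIn-adjacent c k
  ... | inj₁ p       = cong (M (suc i)) p
  ... | inj₂ (p , q) = trans (cong (M (suc i)) p)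
                         (trans (sym (equal (suc i))) (cong (M (suc i)) (sym q)))
  first : cofactor M (inject₁ c) ≡ e * m * d
  first = cong₂ _*_ (cong₂ _*_ (cong sign (Fin.toℕ-inject₁ c)) (equal zero))
                    (det-cong (suc n) same-minor)
  vanish : ∀ j → j ≢ inject₁ c → j ≢ suc c → cofactor M j ≡ 0ℚ
  vanish j p q with punchIn-adjacent⁻ c j p q
  ... | c′ , l , r = trans
    (cong (sign (toℕ j) * M zero j *_) (det-adjacent n c′ (minor M j) λ i →
       trans (cong (M (suc i)) l) (trans (equal (suc i)) (cong (M (suc i)) (sym r)))))
    (*-zeroʳ (sign (toℕ j) * M zero j))

replaceCol : ∀ {n} → Matrix n → Fin n → (Fin n → ℚ) → Matrix n
replaceCol M c v i = updateAt (M i) c (const (v i))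

replaceCol-at : ∀ {n} (M : Matrix n) c i {x} → updateAt (M i) c (const x) c ≡ x
replaceCol-at M c i = updateAt-updates c (M i)

replaceCol-off : ∀ {n} (M : Matrix n) c i {x j} → j ≢ c → updateAt (M i) c (const x) j ≡ M i j
replaceCol-off M c i {x} {j} j≢c = updateAt-minimal j c (M i) j≢c

det-replaceCol-linear : ∀ n (M : Matrix n) c s t u v →
  det n (replaceCol M c (λ i → s * u i + t * v i)) ≡
  s * det n (replaceCol M c u) + t * det n (replaceCol M c v)
det-replaceCol-linear n M c s t u v = det-linear n c s t
  (λ i → trans (replaceCol-at M c i)
     (sym (cong₂ (λ x y → s * x + t * y) (replaceCol-at M c i) (replaceCol-at M c i))))
  (λ i j j≢c → trans (replaceCol-off M c i j≢c) (sym (replaceCol-off M c i j≢c)))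
  (λ i j j≢c → trans (replaceCol-off M c i j≢c) (sym (replaceCol-off M c i j≢c)))

det-replaceCol-sum : ∀ n (M : Matrix n) c m (s : Vector ℚ m) (v : Fin m → Fin n → ℚ) →
  det n (replaceCol M c (λ i → ∑[ k < m ] (s k * v k i))) ≡
  ∑[ k < m ] (s k * det n (replaceCol M c (v k)))
det-replaceCol-sum n M c zero s v = begin
  det n (replaceCol M c (λ _ → 0ℚ))  ≡⟨ det-replaceCol-linear n M c 0ℚ 0ℚ (λ _ → 0ℚ) (λ _ → 0ℚ) ⟩
  0ℚ * d + 0ℚ * d                    ≡⟨ solve 1 (λ d → con 0ℚ :* d :+ con 0ℚ :* d := con 0ℚ) refl d ⟩
  0ℚ                                 ∎
  where
  open ≡-Reasoning
  d = det n (replaceCol M c (λ _ → 0ℚ))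
det-replaceCol-sum n M c (suc m) s v = begin
  det n (replaceCol M c (λ i → s zero * v zero i + rest i))
    ≡⟨ det-cong n (λ i j → cong (λ x → updateAt (M i) c (const x) j)
         (cong (s zero * v zero i +_) (sym (*-identityˡ (rest i))))) ⟩
  det n (replaceCol M c (λ i → s zero * v zero i + 1ℚ * rest i))
    ≡⟨ det-replaceCol-linear n M c (s zero) 1ℚ (v zero) rest ⟩
  s zero * det n (replaceCol M c (v zero)) + 1ℚ * det n (replaceCol M c rest)
    ≡⟨ cong (s zero * det n (replaceCol M c (v zero)) +_)
         (trans (*-identityˡ _) (det-replaceCol-sum n M c m (s ∘ suc) (v ∘ suc))) ⟩
  s zero * det n (replaceCol M c (v zero)) +
    ∑[ k < m ] (s (suc k) * det n (replaceCol M c (v (suc k)))) ∎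
  where
  open ≡-Reasoning
  rest : Fin n → ℚ
  rest i = ∑[ k < m ] (s (suc k) * v (suc k) i)

det-replaceCol-+ : ∀ n (M : Matrix n) c u v →
  det n (replaceCol M c (λ i → u i + v i)) ≡
  det n (replaceCol M c u) + det n (replaceCol M c v)
det-replaceCol-+ n M c u v = begin
  det n (replaceCol M c (λ i → u i + v i))
    ≡⟨ det-cong n (λ i j → cong (λ x → updateAt (M i) c (const x) j)
         (cong₂ _+_ (sym (*-identityˡ (u i))) (sym (*-identityˡ (v i))))) ⟩
  det n (replaceCol M c (λ i → 1ℚ * u i + 1ℚ * v i))
    ≡⟨ det-replaceCol-linear n M c 1ℚ 1ℚ u v ⟩
  1ℚ * det n (replaceCol M c u) + 1ℚ * det n (replaceCol M c v)
    ≡⟨ cong₂ _+_ (*-identityˡ (det n (replaceCol M c u))) (*-identityˡ (det n (replaceCol M c v))) ⟩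
  det n (replaceCol M c u) + det n (replaceCol M c v) ∎
  where open ≡-Reasoning

det-replaceCol-id : ∀ n (M : Matrix n) c {v} → (∀ i → v i ≡ M i c) →
                    det n (replaceCol M c v) ≡ det n M
det-replaceCol-id n M c {v} v≡ = det-cong n λ i j → same i j
  where
  same : ∀ i j → replaceCol M c v i j ≡ M i j
  same i j with j Fin.≟ c
  ... | yes refl = trans (replaceCol-at M c i) (v≡ i)
  ... | no j≢c   = replaceCol-off M c i j≢c

-- Induction on the distance between the two columns: replacing column q, and
-- then its left neighbour r, by the sum of the two changes nothing.
det-alternating< : ∀ n d {p q : Fin n} (M : Matrix n) → toℕ q ≡ toℕ p ℕ.+ suc d →
                   (∀ i → M i p ≡ M i q) → det n M ≡ 0ℚ
det-alternating< (suc n) d {p} {zero} M q≡ _ =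
  contradiction (trans q≡ (ℕ.+-suc (toℕ p) d)) λ ()
det-alternating< (suc n) zero {p} {suc c} M q≡ equal =
  det-adjacent n c M λ i → trans (cong (M i) r≡p) (equal i)
  where
  r≡p : inject₁ c ≡ p
  r≡p = Fin.toℕ-injective (trans (Fin.toℕ-inject₁ c)
          (ℕ.suc-injective (trans q≡ (ℕ.+-comm (toℕ p) 1))))
det-alternating< (suc n) (suc d) {p} {suc c} M q≡ equal = begin
  det (suc n) M
    ≡⟨ +-identityʳ _ ⟨
  det (suc n) M + 0ℚ
    ≡⟨ cong₂ _+_
         (det-replaceCol-id (suc n) M q equal)
         (det-adjacent n c (replaceCol M q w) λ i →
           trans (replaceCol-off M q i r≢q) (sym (replaceCol-at M q i))) ⟨
  det (suc n) (replaceCol M q v) + det (suc n) (replaceCol M q w)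
    ≡⟨ det-replaceCol-+ (suc n) M q v w ⟨
  det (suc n) N
    ≡⟨ det-replaceCol-id (suc n) N r (λ i → sym (replaceCol-off M q i r≢q)) ⟨
  det (suc n) (replaceCol N r w)
    ≡⟨ +-identityˡ _ ⟨
  0ℚ + det (suc n) (replaceCol N r w)
    ≡⟨ cong (_+ det (suc n) (replaceCol N r w))
         (det-alternating< (suc n) d {p} {r} (replaceCol N r v) r≡ λ i →
           trans (replaceCol-off N r i p≢r) (trans (replaceCol-off M q i p≢q)
             (sym (replaceCol-at N r i)))) ⟨
  det (suc n) (replaceCol N r v) + det (suc n) (replaceCol N r w)
    ≡⟨ det-replaceCol-+ (suc n) N r v w ⟨
  det (suc n) (replaceCol N r (λ i → v i + w i))
    ≡⟨ det-adjacent n c (replaceCol N r _) (λ i →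
         trans (replaceCol-at N r i) (sym (trans (replaceCol-off N r i (r≢q ∘ sym))
           (replaceCol-at M q i)))) ⟩
  0ℚ ∎
  where
  open ≡-Reasoning
  q = suc c
  r = inject₁ c
  v w : Fin (suc n) → ℚ
  v i = M i p
  w i = M i r
  N : Matrix (suc n)
  N = replaceCol M q (λ i → v i + w i)
  r≡ : toℕ r ≡ toℕ p ℕ.+ suc d
  r≡ = trans (Fin.toℕ-inject₁ c) (ℕ.suc-injective (trans q≡ (ℕ.+-suc (toℕ p) (suc d))))
  m≢m+1+n : ∀ m n → m ≢ m ℕ.+ suc n
  m≢m+1+n m n eq = ℕ.m+1+n≢m m (sym eq)
  p≢r : p ≢ r
  p≢r eq = m≢m+1+n (toℕ p) d (trans (cong toℕ eq) r≡)
  p≢q : p ≢ q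
  p≢q eq = m≢m+1+n (toℕ p) (suc d) (trans (cong toℕ eq) q≡)
  r≢q : r ≢ q
  r≢q eq = ℕ.1+n≢n (sym (trans (sym (Fin.toℕ-inject₁ c)) (cong toℕ eq)))

det-alternating : ∀ n {p q : Fin n} (M : Matrix n) → p ≢ q →
                  (∀ i → M i p ≡ M i q) → det n M ≡ 0ℚ
det-alternating n {p} {q} M p≢q equal with ℕ.<-cmp (toℕ p) (toℕ q)
... | tri< p<q _ _ = det-alternating< n (toℕ q ∸ suc (toℕ p)) M (m<n⇒n≡m+suc[n∸suc[m]] p<q) equal
... | tri≈ _ p≡q _ = contradiction (Fin.toℕ-injective p≡q) p≢q
... | tri> _ _ q<p = det-alternating< n (toℕ p ∸ suc (toℕ q)) M (m<n⇒n≡m+suc[n∸suc[m]] q<p) (sym ∘ equal)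

sum-single : ∀ {n} (c : Fin n) (g : Vector ℚ n) → (∀ j → j ≢ c → g j ≡ 0ℚ) → sum g ≡ g c
sum-single zero g z = trans (cong (g zero +_) (sum-zero λ j → z (suc j) λ ())) (+-identityʳ (g zero))
sum-single (suc c) g z = trans
  (cong₂ _+_ (z zero λ ()) (sum-single c (g ∘ suc) λ j j≢c → z (suc j) (j≢c ∘ Fin.suc-injective)))
  (+-identityˡ (g (suc c)))

-- Expanding column c of M by linearity puts column k of N in position c. For k ≠ c that column then
-- occurs twice, so only the multiple `s c` of `det n N` survives.
det-column-combination : ∀ n (c : Fin n) (s : Vector ℚ n) (M N : Matrix n) →
  (∀ i j → j ≢ c → M i j ≡ N i j) →
  (∀ i → M i c ≡ ∑[ k < n ] (s k * N i k)) →
  det n M ≡ s c * det n N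
det-column-combination n c s M N off at = begin
  det n M
    ≡⟨ det-cong n M≡ ⟩
  det n (replaceCol N c (λ i → ∑[ k < n ] (s k * N i k)))
    ≡⟨ det-replaceCol-sum n N c n s (λ k i → N i k) ⟩
  ∑[ k < n ] (s k * det n (replaceCol N c (λ i → N i k)))
    ≡⟨ sum-single c _ (λ k k≢c → trans (cong (s k *_)
         (det-alternating n (replaceCol N c (λ i → N i k)) k≢c λ i →
           trans (replaceCol-off N c i k≢c) (sym (replaceCol-at N c i))))
         (*-zeroʳ (s k))) ⟩
  s c * det n (replaceCol N c (λ i → N i c))
    ≡⟨ cong (s c *_) (det-replaceCol-id n N c (λ i → refl)) ⟩
  s c * det n N ∎
  where
  open ≡-Reasoning
  M≡ : ∀ i j → M i j ≡ replaceCol N c (λ i → ∑[ k < n ] (s k * N i k)) i j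
  M≡ i j with j Fin.≟ c
  ... | yes refl = trans (at i) (sym (replaceCol-at N c i))
  ... | no j≢c   = trans (off i j j≢c) (sym (replaceCol-off N c i j≢c))

prod : (ℕ → ℚ) → ℕ → ℚ
prod g zero    = 1ℚ
prod g (suc n) = prod g n * g n

prod-front : ∀ g n → prod g (suc n) ≡ g 0 * prod (g ∘ suc) n
prod-front g zero    = *-comm 1ℚ (g 0)
prod-front g (suc n) = trans (cong (_* g (suc n)) (prod-front g n)) (*-assoc (g 0) _ (g (suc n)))

prod-* : ∀ g h n → prod (λ k → g k * h k) n ≡ prod g n * prod h n
prod-* g h zero    = refl
prod-* g h (suc n) = trans (cong (_* (g n * h n)) (prod-* g h n))
  (solve 4 (λ p q x y → p :* q :* (x :* y) := p :* x :* (q :* y)) refl (prod g n) (prod h n) (g n) (h n))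

-- The entries come from a function on natural numbers, so that the only contributing minor is again
-- of this form, with both indices shifted.
det-lowerTriangular : ∀ n (l : ℕ → ℕ → ℚ) → (∀ {i k} → i ℕ.< k → l i k ≡ 0ℚ) →
  det n (λ i k → l (toℕ i) (toℕ k)) ≡ prod (λ k → l k k) n
det-lowerTriangular zero    l lower = refl
det-lowerTriangular (suc n) l lower = begin
  1ℚ * l 0 0 * d + sum (λ j → cofactor L (suc j))
    ≡⟨ cong₂ _+_
         (cong₂ _*_ (*-identityˡ (l 0 0)) (det-lowerTriangular n _ (lower ∘ s≤s)))
         (sum-zero λ j → trans
           (cong (λ x → sign (toℕ (suc j)) * x * det n (minor L (suc j))) (lower (s≤s z≤n)))
           (solve 2 (λ e d → e :* con 0ℚ :* d := con 0ℚ) refl (sign (toℕ (suc j))) (det n (minor L (suc j))))) ⟩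
  l 0 0 * prod (λ k → l (suc k) (suc k)) n + 0ℚ  ≡⟨ +-identityʳ _ ⟩
  l 0 0 * prod (λ k → l (suc k) (suc k)) n       ≡⟨ prod-front (λ k → l k k) n ⟨
  prod (λ k → l k k) (suc n)                     ∎
  where
  open ≡-Reasoning
  L : Matrix (suc n)
  L i k = l (toℕ i) (toℕ k)
  d = det n (minor L zero)

-- `mixed t` has the first t columns of L and the remaining ones of LU, so it runs from LU to L.
-- Column t of LU combines the columns of L with coefficients `u k t`; those with k ≤ t already
-- stand in `mixed (suc t)`, and passing to it splits off the factor `u t t`.
det-LU : ∀ n (l u : ℕ → ℕ → ℚ) →
  (∀ {i k} → i ℕ.< k → l i k ≡ 0ℚ) → (∀ {k j} → j ℕ.< k → u k j ≡ 0ℚ) →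
  det n (λ i j → ∑[ k < n ] (l (toℕ i) (toℕ k) * u (toℕ k) (toℕ j))) ≡
  prod (λ k → l k k * u k k) n
det-LU n l u lower upper = begin
  det n LU                                    ≡⟨ reduce n ℕ.≤-refl ⟩
  prod (λ k → u k k) n * det n (mixed n)      ≡⟨ cong (prod (λ k → u k k) n *_)
      (trans (det-cong n λ i j → mixed-< i (Fin.toℕ<n j)) (det-lowerTriangular n l lower)) ⟩
  prod (λ k → u k k) n * prod (λ k → l k k) n ≡⟨ *-comm (prod (λ k → u k k) n) _ ⟩
  prod (λ k → l k k) n * prod (λ k → u k k) n ≡⟨ prod-* (λ k → l k k) (λ k → u k k) n ⟨
  prod (λ k → l k k * u k k) n                ∎
  where
  open ≡-Reasoning
  LU : Matrix n
  LU i j = ∑[ k < n ] (l (toℕ i) (toℕ k) * u (toℕ k) (toℕ j))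

  mixed : ℕ → Matrix n
  mixed t i j with toℕ j ℕ.<? t
  ... | yes _ = l (toℕ i) (toℕ j)
  ... | no  _ = LU i j

  mixed-< : ∀ {t} i {j} → toℕ j ℕ.< t → mixed t i j ≡ l (toℕ i) (toℕ j)
  mixed-< {t} i {j} j<t with toℕ j ℕ.<? t
  ... | yes _  = refl
  ... | no j≮t = contradiction j<t j≮t

  mixed-≥ : ∀ {t} i {j} → t ℕ.≤ toℕ j → mixed t i j ≡ LU i j
  mixed-≥ {t} i {j} t≤j with toℕ j ℕ.<? t
  ... | yes j<t = contradiction t≤j (ℕ.<⇒≱ j<t)
  ... | no _    = refl

  step : ∀ {t} (t<n : t ℕ.< n) → det n (mixed t) ≡ u t t * det n (mixed (suc t))
  step {t} t<n = trans
    (det-column-combination n c (λ k → u (toℕ k) t) (mixed t) (mixed (suc t)) off at)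
    (cong (λ m → u m t * det n (mixed (suc t))) c≡t)
    where
    c = fromℕ< t<n
    c≡t : toℕ c ≡ t
    c≡t = Fin.toℕ-fromℕ< t<n
    off : ∀ i j → j ≢ c → mixed t i j ≡ mixed (suc t) i j
    off i j j≢c with ℕ.<-cmp (toℕ j) t
    ... | tri< j<t _ _ = trans (mixed-< i j<t) (sym (mixed-< i (ℕ.m<n⇒m<1+n j<t)))
    ... | tri≈ _ j≡t _ = contradiction (Fin.toℕ-injective (trans j≡t (sym c≡t))) j≢c
    ... | tri> _ _ t<j = trans (mixed-≥ i (ℕ.<⇒≤ t<j)) (sym (mixed-≥ i t<j))
    at : ∀ i → mixed t i c ≡ ∑[ k < n ] (u (toℕ k) t * mixed (suc t) i k)
    at i = trans (mixed-≥ i (ℕ.≤-reflexive (sym c≡t))) (sum-cong-≗ term)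
      where
      term : ∀ k → l (toℕ i) (toℕ k) * u (toℕ k) (toℕ c) ≡ u (toℕ k) t * mixed (suc t) i k
      term k with toℕ k ℕ.≤? t
      ... | yes k≤t = trans (*-comm (l (toℕ i) (toℕ k)) _)
              (cong₂ _*_ (cong (u (toℕ k)) c≡t) (sym (mixed-< i (s≤s k≤t))))
      -- Here column k of `mixed (suc t)` may belong to LU instead of L, but its coefficient `u k t`
      -- is 0.
      ... | no k≰t  = trans
              (trans (cong (l (toℕ i) (toℕ k) *_) (trans (cong (u (toℕ k)) c≡t) (upper (ℕ.≰⇒> k≰t))))
                     (*-zeroʳ (l (toℕ i) (toℕ k))))
              (sym (trans (cong (_* mixed (suc t) i k) (upper (ℕ.≰⇒> k≰t)))
                          (*-zeroˡ (mixed (suc t) i k))))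

  reduce : ∀ t → t ℕ.≤ n → det n LU ≡ prod (λ k → u k k) t * det n (mixed t)
  reduce zero    _   = trans (det-cong n λ i j → sym (mixed-≥ {0} i z≤n)) (sym (*-identityˡ _))
  reduce (suc t) t<n = trans (reduce t (ℕ.<⇒≤ t<n))
    (trans (cong (prod (λ k → u k k) t *_) (step t<n)) (sym (*-assoc (prod (λ k → u k k) t) _ _)))

-- Exponential generating series

fromℕ-+ : ∀ m n → fromℕ (m ℕ.+ n) ≡ fromℕ m + fromℕ n
fromℕ-+ m n = toℚᵘ-injective
  (ℚᵘ.≃-trans (toℚᵘ-fromℚᵘ (ℚᵘ.mkℚᵘ (ℤ.+ (m ℕ.+ n)) 0))
  (ℚᵘ.≃-trans (ℚᵘ.*≡* (cong (ℤ._* ℤ.1ℤ)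
                (sym (cong₂ ℤ._+_ (ℤ.*-identityʳ (ℤ.+ m)) (ℤ.*-identityʳ (ℤ.+ n))))))
  (ℚᵘ.≃-sym (ℚᵘ.≃-trans (toℚᵘ-homo-+ (fromℕ m) (fromℕ n))
    (ℚᵘ.+-cong (toℚᵘ-fromℚᵘ (ℚᵘ.mkℚᵘ (ℤ.+ m) 0)) (toℚᵘ-fromℚᵘ (ℚᵘ.mkℚᵘ (ℤ.+ n) 0)))))))

fromℕ-* : ∀ m n → fromℕ (m ℕ.* n) ≡ fromℕ m * fromℕ n
fromℕ-* m n = toℚᵘ-injective
  (ℚᵘ.≃-trans (toℚᵘ-fromℚᵘ (ℚᵘ.mkℚᵘ (ℤ.+ (m ℕ.* n)) 0))
  (ℚᵘ.≃-trans (ℚᵘ.*≡* (cong (ℤ._* ℤ.1ℤ) (ℤ.pos-* m n)))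
  (ℚᵘ.≃-sym (ℚᵘ.≃-trans (toℚᵘ-homo-* (fromℕ m) (fromℕ n))
    (ℚᵘ.*-cong (toℚᵘ-fromℚᵘ (ℚᵘ.mkℚᵘ (ℤ.+ m) 0)) (toℚᵘ-fromℚᵘ (ℚᵘ.mkℚᵘ (ℤ.+ n) 0)))))))

fromℕ-suc : ∀ n → fromℕ (suc n) ≡ 1ℚ + fromℕ n
fromℕ-suc = fromℕ-+ 1

-- Sequences s are identified with their exponential generating series
-- Σ_k s_k x^k / k!; then D is d/dx, and the Leibniz rule defines the product.
Seq : Set
Seq = ℕ → ℚ

D : Seq → Seq
D g n = g (suc n)

infixl 7 _⋆_

_⋆_ : Seq → Seq → Seq
(g ⋆ h) zero    = g 0 * h 0
(g ⋆ h) (suc n) = (D g ⋆ h) n + (g ⋆ D h) n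

⋆-cong : ∀ {g g′ h h′} → g ≗ g′ → h ≗ h′ → g ⋆ h ≗ g′ ⋆ h′
⋆-cong p q zero    = cong₂ _*_ (p 0) (q 0)
⋆-cong p q (suc n) = cong₂ _+_ (⋆-cong (p ∘ suc) q n) (⋆-cong p (q ∘ suc) n)

⋆-comm : ∀ g h → g ⋆ h ≗ h ⋆ g
⋆-comm g h zero    = *-comm (g 0) (h 0)
⋆-comm g h (suc n) = trans (cong₂ _+_ (⋆-comm (D g) h n) (⋆-comm g (D h) n))
                           (+-comm ((h ⋆ D g) n) ((D h ⋆ g) n))

⋆-linearʳ : ∀ g s h t k →
            g ⋆ (λ n → s * h n + t * k n) ≗ λ n → s * (g ⋆ h) n + t * (g ⋆ k) n
⋆-linearʳ g s h t k zero =
  solve 5 (λ g s h t k → g :* (s :* h :+ t :* k) := s :* (g :* h) :+ t :* (g :* k))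
    refl (g 0) s (h 0) t (k 0)
⋆-linearʳ g s h t k (suc n) =
  trans (cong₂ _+_ (⋆-linearʳ (D g) s h t k n) (⋆-linearʳ g s (D h) t (D k) n))
    (solve 6 (λ s t a b c d →
       (s :* a :+ t :* b) :+ (s :* c :+ t :* d) := s :* (a :+ c) :+ t :* (b :+ d))
       refl s t ((D g ⋆ h) n) ((D g ⋆ k) n) ((g ⋆ D h) n) ((g ⋆ D k) n))

⋆-distribˡ : ∀ g h k → g ⋆ (λ n → h n + k n) ≗ λ n → (g ⋆ h) n + (g ⋆ k) n
⋆-distribˡ g h k n = trans
  (⋆-cong {g} (λ _ → refl) (λ i → cong₂ _+_ (sym (*-identityˡ (h i))) (sym (*-identityˡ (k i)))) n)
  (trans (⋆-linearʳ g 1ℚ h 1ℚ k n) (cong₂ _+_ (*-identityˡ ((g ⋆ h) n)) (*-identityˡ ((g ⋆ k) n))))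

⋆-distribʳ : ∀ g h k → (λ n → g n + h n) ⋆ k ≗ λ n → (g ⋆ k) n + (h ⋆ k) n
⋆-distribʳ g h k n = trans (⋆-comm _ k n) (trans (⋆-distribˡ k g h n)
  (cong₂ _+_ (⋆-comm k g n) (⋆-comm k h n)))

⋆-scaleʳ : ∀ g s h → g ⋆ (λ n → s * h n) ≗ λ n → s * (g ⋆ h) n
⋆-scaleʳ g s h zero    = solve 3 (λ g s h → g :* (s :* h) := s :* (g :* h)) refl (g 0) s (h 0)
⋆-scaleʳ g s h (suc n) = trans (cong₂ _+_ (⋆-scaleʳ (D g) s h n) (⋆-scaleʳ g s (D h) n))
                               (sym (*-distribˡ-+ s ((D g ⋆ h) n) ((g ⋆ D h) n)))

⋆-scaleˡ : ∀ s g h → (λ n → s * g n) ⋆ h ≗ λ n → s * (g ⋆ h) n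
⋆-scaleˡ s g h n = trans (⋆-comm _ h n) (trans (⋆-scaleʳ h s g n) (cong (s *_) (⋆-comm h g n)))

⋆-zeroʳ : ∀ g n → (g ⋆ (λ _ → 0ℚ)) n ≡ 0ℚ
⋆-zeroʳ g zero    = *-zeroʳ (g 0)
⋆-zeroʳ g (suc n) = cong₂ _+_ (⋆-zeroʳ (D g) n) (⋆-zeroʳ g n)

⋆-identityʳ : ∀ g → g ⋆ 1S ≗ g
⋆-identityʳ g zero    = *-identityʳ (g 0)
⋆-identityʳ g (suc n) = trans (cong₂ _+_ (⋆-identityʳ (D g) n) (⋆-zeroʳ g n)) (+-identityʳ (g (suc n)))

-- Both sides differentiate to the same sum of three products, so induction along the Leibniz rule
-- suffices and no binomial sums appear.
⋆-assoc : ∀ g h k → (g ⋆ h) ⋆ k ≗ g ⋆ (h ⋆ k)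
⋆-assoc g h k zero    = *-assoc (g 0) (h 0) (k 0)
⋆-assoc g h k (suc n) = begin
  (D (g ⋆ h) ⋆ k) n + ((g ⋆ h) ⋆ D k) n
    ≡⟨ cong₂ _+_ (⋆-distribʳ (D g ⋆ h) (g ⋆ D h) k n) (⋆-assoc g h (D k) n) ⟩
  (((D g ⋆ h) ⋆ k) n + ((g ⋆ D h) ⋆ k) n) + (g ⋆ (h ⋆ D k)) n
    ≡⟨ cong₂ (λ x y → x + y + (g ⋆ (h ⋆ D k)) n) (⋆-assoc (D g) h k n) (⋆-assoc g (D h) k n) ⟩
  ((D g ⋆ (h ⋆ k)) n + (g ⋆ (D h ⋆ k)) n) + (g ⋆ (h ⋆ D k)) n
    ≡⟨ +-assoc ((D g ⋆ (h ⋆ k)) n) _ _ ⟩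
  (D g ⋆ (h ⋆ k)) n + ((g ⋆ (D h ⋆ k)) n + (g ⋆ (h ⋆ D k)) n)
    ≡⟨ cong ((D g ⋆ (h ⋆ k)) n +_) (⋆-distribˡ g (D h ⋆ k) (h ⋆ D k) n) ⟨
  (D g ⋆ (h ⋆ k)) n + (g ⋆ D (h ⋆ k)) n ∎
  where open ≡-Reasoning

-- In the n-fold Leibniz expansion only the term with all derivatives on h reaches order n of h, and
-- it occurs once.
⋆-leading : ∀ n g h → (∀ {i} → i ℕ.< n → h i ≡ 0ℚ) → (g ⋆ h) n ≡ g 0 * h n
⋆-leading zero    g h h≡0 = refl
⋆-leading (suc n) g h h≡0 = begin
  (D g ⋆ h) n + (g ⋆ D h) n      ≡⟨ cong₂ _+_ (⋆-leading n (D g) h (h≡0 ∘ ℕ.m<n⇒m<1+n)) (⋆-leading n g (D h) (h≡0 ∘ s≤s)) ⟩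
  g 1 * h n + g 0 * h (suc n)    ≡⟨ cong (λ x → g 1 * x + g 0 * h (suc n)) (h≡0 ℕ.≤-refl) ⟩
  g 1 * 0ℚ + g 0 * h (suc n)     ≡⟨ solve 2 (λ x y → x :* con 0ℚ :+ y := y) refl (g 1) (g 0 * h (suc n)) ⟩
  g 0 * h (suc n)                ∎
  where open ≡-Reasoning

-- By `⋆-leading`, the lowest nonzero coefficient of h - k would survive in g ⋆ (h - k). Only the
-- first N coefficients are compared, because a truncated sine expansion is known to satisfy the
-- equation for f only that far.
⋆-cancelˡ : ∀ N g h k → g 0 ≡ 1ℚ → (∀ {j} → j ℕ.< N → (g ⋆ h) j ≡ (g ⋆ k) j) →
            ∀ {j} → j ℕ.< N → h j ≡ k j
⋆-cancelˡ N g h k g₀≡1 eq j<N = difference (vanish N ℕ.≤-refl j<N)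
  where
  open ≡-Reasoning
  d : Seq
  d n = 1ℚ * h n + (- 1ℚ) * k n
  difference : ∀ {j} → d j ≡ 0ℚ → h j ≡ k j
  difference {j} d≡0 = begin
    h j        ≡⟨ solve 2 (λ x y → x := (con 1ℚ :* x :+ (:- con 1ℚ) :* y) :+ y) refl (h j) (k j) ⟩
    d j + k j  ≡⟨ cong (_+ k j) d≡0 ⟩
    0ℚ + k j   ≡⟨ +-identityˡ (k j) ⟩
    k j        ∎
  vanish : ∀ n → n ℕ.≤ N → ∀ {j} → j ℕ.< n → d j ≡ 0ℚ
  vanish (suc n) n<N {j} j<1+n with ℕ.m<1+n⇒m<n∨m≡n j<1+n
  ... | inj₁ j<n  = vanish n (ℕ.<⇒≤ n<N) j<n
  ... | inj₂ refl = begin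
    d n                                        ≡⟨ *-identityˡ (d n) ⟨
    1ℚ * d n                                   ≡⟨ cong (_* d n) g₀≡1 ⟨
    g 0 * d n                                  ≡⟨ ⋆-leading n g d (vanish n (ℕ.<⇒≤ n<N)) ⟨
    (g ⋆ d) n                                  ≡⟨ ⋆-linearʳ g 1ℚ h (- 1ℚ) k n ⟩
    1ℚ * (g ⋆ h) n + (- 1ℚ) * (g ⋆ k) n        ≡⟨ cong (λ x → 1ℚ * x + (- 1ℚ) * (g ⋆ k) n) (eq n<N) ⟩
    1ℚ * (g ⋆ k) n + (- 1ℚ) * (g ⋆ k) n        ≡⟨ solve 1 (λ x → con 1ℚ :* x :+ (:- con 1ℚ) :* x := con 0ℚ) refl ((g ⋆ k) n) ⟩
    0ℚ                                         ∎

-- Cosine, sine and divided powers of the sine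

cosSeq : Seq
cosSeq = evens sign

sinSeq : Seq
sinSeq n = - cosSeq (suc n)

evens-neg : ∀ s → (∀ k → s (suc k) ≡ - s k) → ∀ n → evens s (suc (suc n)) ≡ - evens s n
evens-neg s alt 0             = alt 0
evens-neg s alt 1             = refl
evens-neg s alt (suc (suc n)) = evens-neg (s ∘ suc) (alt ∘ suc) n

D-sin : D sinSeq ≗ cosSeq
D-sin n = trans (cong -_ (evens-neg sign sign-suc n)) (solve 1 (λ x → :- (:- x) := x) refl (cosSeq n))

D-cos : D cosSeq ≗ λ n → (- 1ℚ) * sinSeq n
D-cos n = solve 1 (λ x → x := (:- con 1ℚ) :* (:- x)) refl (cosSeq (suc n))

-- The constant term is 1 and the derivative cancels.
cos²+sin² : ∀ n → (cosSeq ⋆ cosSeq) n + (sinSeq ⋆ sinSeq) n ≡ 1S n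
cos²+sin² zero    = refl
cos²+sin² (suc n) = begin
  (D cosSeq ⋆ cosSeq) n + (cosSeq ⋆ D cosSeq) n + ((D sinSeq ⋆ sinSeq) n + (sinSeq ⋆ D sinSeq) n)
    ≡⟨ cong₂ _+_ (cong₂ _+_ dcc (trans (⋆-comm cosSeq (D cosSeq) n) dcc))
                 (cong₂ _+_ dss (trans (⋆-comm sinSeq (D sinSeq) n) dss)) ⟩
  (- 1ℚ) * x + (- 1ℚ) * x + (x + x)
    ≡⟨ solve 1 (λ x → (:- con 1ℚ) :* x :+ (:- con 1ℚ) :* x :+ (x :+ x) := con 0ℚ) refl x ⟩
  0ℚ ∎
  where
  open ≡-Reasoning
  x = (cosSeq ⋆ sinSeq) n
  dcc : (D cosSeq ⋆ cosSeq) n ≡ (- 1ℚ) * x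
  dcc = trans (⋆-cong {h = cosSeq} D-cos (λ _ → refl) n) (trans (⋆-scaleˡ (- 1ℚ) sinSeq cosSeq n)
          (cong ((- 1ℚ) *_) (⋆-comm sinSeq cosSeq n)))
  dss : (D sinSeq ⋆ sinSeq) n ≡ x
  dss = ⋆-cong {h = sinSeq} D-sin (λ _ → refl) n

integral : Seq → Seq
integral g zero    = 0ℚ
integral g (suc n) = g n

-- sin^m x / m!
sinPow : ℕ → Seq
sinPow zero    = 1S
sinPow (suc m) = integral (cosSeq ⋆ sinPow m)

sinPow-< : ∀ {m n} → n ℕ.< m → sinPow m n ≡ 0ℚ
sinPow-< {suc m} {zero}  _         = refl
sinPow-< {suc m} {suc n} (s≤s n<m) = trans
  (⋆-leading n cosSeq (sinPow m) (λ i<n → sinPow-< (ℕ.<-trans i<n n<m)))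
  (cong (cosSeq 0 *_) (sinPow-< n<m))

sinPow-diag : ∀ m → sinPow m m ≡ 1ℚ
sinPow-diag zero    = refl
sinPow-diag (suc m) = trans (⋆-leading m cosSeq (sinPow m) sinPow-<)
                            (cong (cosSeq 0 *_) (sinPow-diag m))

-- `sinPow` is defined by integration, which avoids dividing by m!; this identity shows that it does
-- consist of divided powers of the sine. Both sides vanish at 0, and their derivatives agree by the
-- product rule and, for positive m, the case m - 1.
sin⋆sinPow : ∀ m → sinSeq ⋆ sinPow m ≗ λ n → fromℕ (suc m) * sinPow (suc m) n
sin⋆sinPow m zero = trans (*-zeroˡ (sinPow m 0)) (sym (*-zeroʳ (fromℕ (suc m))))
sin⋆sinPow zero (suc n) = trans
  (cong₂ _+_ (⋆-cong {h = sinPow 0} D-sin (λ _ → refl) n) (⋆-zeroʳ sinSeq n))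
  (solve 1 (λ x → x :+ con 0ℚ := con 1ℚ :* x) refl ((cosSeq ⋆ sinPow 0) n))
sin⋆sinPow (suc m) (suc n) = begin
  (D sinSeq ⋆ sinPow (suc m)) n + (sinSeq ⋆ (cosSeq ⋆ sinPow m)) n
    ≡⟨ cong₂ _+_ (⋆-cong {h = sinPow (suc m)} D-sin (λ _ → refl) n) swapped ⟩
  x + fromℕ (suc m) * x
    ≡⟨ solve 2 (λ x k → x :+ k :* x := (con 1ℚ :+ k) :* x) refl x (fromℕ (suc m)) ⟩
  (1ℚ + fromℕ (suc m)) * x
    ≡⟨ cong (_* x) (fromℕ-suc (suc m)) ⟨
  fromℕ (suc (suc m)) * x ∎
  where
  open ≡-Reasoning
  x = (cosSeq ⋆ sinPow (suc m)) n
  swapped : (sinSeq ⋆ (cosSeq ⋆ sinPow m)) n ≡ fromℕ (suc m) * x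
  swapped = begin
    (sinSeq ⋆ (cosSeq ⋆ sinPow m)) n   ≡⟨ ⋆-assoc sinSeq cosSeq (sinPow m) n ⟨
    (sinSeq ⋆ cosSeq ⋆ sinPow m) n     ≡⟨ ⋆-cong {h = sinPow m} (⋆-comm sinSeq cosSeq) (λ _ → refl) n ⟩
    (cosSeq ⋆ sinSeq ⋆ sinPow m) n     ≡⟨ ⋆-assoc cosSeq sinSeq (sinPow m) n ⟩
    (cosSeq ⋆ (sinSeq ⋆ sinPow m)) n   ≡⟨ ⋆-cong {cosSeq} (λ _ → refl) (sin⋆sinPow m) n ⟩
    (cosSeq ⋆ (λ i → fromℕ (suc m) * sinPow (suc m) i)) n
                                       ≡⟨ ⋆-scaleʳ cosSeq (fromℕ (suc m)) (sinPow (suc m)) n ⟩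
    fromℕ (suc m) * x                  ∎

D-cos⋆sinPow : ∀ m n → (D cosSeq ⋆ sinPow m) n ≡ (- 1ℚ) * (fromℕ (suc m) * sinPow (suc m) n)
D-cos⋆sinPow m n = trans (⋆-cong {h = sinPow m} D-cos (λ _ → refl) n)
  (trans (⋆-scaleˡ (- 1ℚ) sinSeq (sinPow m) n) (cong ((- 1ℚ) *_) (sin⋆sinPow m n)))

sinPow-D²-1 : ∀ n → sinPow 1 (suc (suc n)) ≡ - sinPow 1 n
sinPow-D²-1 n = trans (cong₂ _+_ (D-cos⋆sinPow 0 n) (⋆-zeroʳ cosSeq n))
  (solve 1 (λ x → (:- con 1ℚ) :* (con 1ℚ :* x) :+ con 0ℚ := :- x) refl (sinPow 1 n))

-- With M = m + 2, the factor M² arises as M + M(M-1): the first part from differentiating the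
-- cosine in cos · sin^(M-1)/(M-1)!, the second from cos² = 1 - sin².
sinPow-D² : ∀ m n → sinPow (suc (suc m)) (suc (suc n)) ≡
            sinPow m n - fromℕ (suc (suc m)) * fromℕ (suc (suc m)) * sinPow (suc (suc m)) n
sinPow-D² m n = begin
  (D cosSeq ⋆ sinPow (suc m)) n + (cosSeq ⋆ (cosSeq ⋆ sinPow m)) n
    ≡⟨ cong₂ _+_ (D-cos⋆sinPow (suc m) n) cos² ⟩
  (- 1ℚ) * (fromℕ (suc (suc m)) * y) + (x - fromℕ (suc m) * (fromℕ (suc (suc m)) * y))
    ≡⟨ cong (λ k → (- 1ℚ) * (k * y) + (x - fromℕ (suc m) * (k * y))) (fromℕ-suc (suc m)) ⟩
  (- 1ℚ) * ((1ℚ + k) * y) + (x - k * ((1ℚ + k) * y))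
    ≡⟨ solve 3 (λ x y k → (:- con 1ℚ) :* ((con 1ℚ :+ k) :* y) :+ (x :- k :* ((con 1ℚ :+ k) :* y))
         := x :- (con 1ℚ :+ k) :* (con 1ℚ :+ k) :* y) refl x y k ⟩
  x - (1ℚ + k) * (1ℚ + k) * y
    ≡⟨ cong (λ k → x - k * k * y) (fromℕ-suc (suc m)) ⟨
  x - fromℕ (suc (suc m)) * fromℕ (suc (suc m)) * y ∎
  where
  open ≡-Reasoning
  k = fromℕ (suc m)
  x = sinPow m n
  y = sinPow (suc (suc m)) n
  z = (cosSeq ⋆ cosSeq ⋆ sinPow m) n
  w = (sinSeq ⋆ sinSeq ⋆ sinPow m) n
  sin² : w ≡ fromℕ (suc m) * (fromℕ (suc (suc m)) * y)
  sin² = trans (⋆-assoc sinSeq sinSeq (sinPow m) n)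
    (trans (⋆-cong {sinSeq} (λ _ → refl) (sin⋆sinPow m) n)
    (trans (⋆-scaleʳ sinSeq (fromℕ (suc m)) (sinPow (suc m)) n)
           (cong (fromℕ (suc m) *_) (sin⋆sinPow (suc m) n))))
  z+w : z + w ≡ x
  z+w = trans (sym (⋆-distribʳ (cosSeq ⋆ cosSeq) (sinSeq ⋆ sinSeq) (sinPow m) n))
    (trans (⋆-cong {h = sinPow m} cos²+sin² (λ _ → refl) n)
    (trans (⋆-comm 1S (sinPow m) n) (⋆-identityʳ (sinPow m) n)))
  cos² : (cosSeq ⋆ (cosSeq ⋆ sinPow m)) n ≡ x - fromℕ (suc m) * (fromℕ (suc (suc m)) * y)
  cos² = trans (sym (⋆-assoc cosSeq cosSeq (sinPow m) n))
    (trans (solve 2 (λ z w → z := (z :+ w) :- w) refl z w) (cong₂ _-_ z+w sin²))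

-- Expansion in powers of the sine

∑< : (ℕ → ℚ) → ℕ → ℚ
∑< g n = ∑[ i < n ] g (toℕ i)

∑<-cong : ∀ {g h} n → (∀ {k} → k ℕ.< n → g k ≡ h k) → ∑< g n ≡ ∑< h n
∑<-cong n g≡h = sum-cong-≗ {n} λ i → g≡h (Fin.toℕ<n i)

∑<-zero : ∀ {g} n → (∀ {k} → k ℕ.< n → g k ≡ 0ℚ) → ∑< g n ≡ 0ℚ
∑<-zero n g≡0 = sum-zero {n} λ i → g≡0 (Fin.toℕ<n i)

∑<-last : ∀ g n → ∑< g (suc n) ≡ ∑< g n + g n
∑<-last g zero    = +-comm (g 0) 0ℚ
∑<-last g (suc n) = trans (cong (g 0 +_) (∑<-last (g ∘ suc) n)) (sym (+-assoc (g 0) _ (g (suc n))))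

∑<-extend : ∀ g {n} N → n ℕ.≤ N → (∀ {k} → n ℕ.≤ k → g k ≡ 0ℚ) → ∑< g N ≡ ∑< g n
∑<-extend g zero z≤n g≡0 = refl
∑<-extend g {n} (suc N) n≤1+N g≡0 with ℕ.m≤n⇒m<n∨m≡n n≤1+N
... | inj₂ refl      = refl
... | inj₁ (s≤s n≤N) = trans (∑<-last g N)
  (trans (cong₂ _+_ (∑<-extend g N n≤N g≡0) (g≡0 n≤N)) (+-identityʳ (∑< g n)))

-- The bound N does not depend on the coefficient index n, so this is a finite linear combination of
-- series, to which products and derivatives apply termwise.
expand : Seq → ℕ → Seq
expand w N n = ∑< (λ m → w m * sinPow m n) N

-- The locally finite sum Σ_m w_m sin^m x / m!: only m ≤ n contribute to entry n.
sinSeries : Seq → Seq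
sinSeries w n = expand w (suc n) n

expand≡sinSeries : ∀ w N {n} → n ℕ.< N → expand w N n ≡ sinSeries w n
expand≡sinSeries w N {n} n<N = ∑<-extend _ N n<N λ {k} n<k →
  trans (cong (w k *_) (sinPow-< n<k)) (*-zeroʳ (w k))

D²-coeff : Seq → Seq
D²-coeff w m = w (suc (suc m)) - fromℕ m * fromℕ m * w m

-- Differentiating twice sends the term in s^m to terms in s^(m-2) and s^m. Powers below s^N receive
-- both kinds of contribution; s^N and s^(N+1) lack the one from above, hence the two corrections.
expand-D² : ∀ w N n → expand w (suc (suc N)) (suc (suc n)) ≡
  expand (D²-coeff w) N n - fromℕ N * fromℕ N * w N * sinPow N n
    - fromℕ (suc N) * fromℕ (suc N) * w (suc N) * sinPow (suc N) n
expand-D² w zero n = trans (cong (λ s → w 0 * 0ℚ + (w 1 * s + 0ℚ)) (sinPow-D²-1 n))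
  (solve 4 (λ w₀ w₁ p q → w₀ :* con 0ℚ :+ (w₁ :* (:- q) :+ con 0ℚ)
     := con 0ℚ :- con 0ℚ :* con 0ℚ :* w₀ :* p :- con 1ℚ :* con 1ℚ :* w₁ :* q)
     refl (w 0) (w 1) (sinPow 0 n) (sinPow 1 n))
expand-D² w (suc N) n = begin
  expand w (3 ℕ.+ N) (2 ℕ.+ n)
    ≡⟨ ∑<-last (λ m → w m * sinPow m (2 ℕ.+ n)) (2 ℕ.+ N) ⟩
  expand w (2 ℕ.+ N) (2 ℕ.+ n) + w (2 ℕ.+ N) * sinPow (2 ℕ.+ N) (2 ℕ.+ n)
    ≡⟨ cong₂ (λ x y → x + w (2 ℕ.+ N) * y) (expand-D² w N n) (sinPow-D² N n) ⟩
  (e - a₀ * w N * s₀ - r) + w (2 ℕ.+ N) * (s₀ - a₂ * s₂)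
    ≡⟨ solve 8 (λ e a₀ w₀ s₀ r w₂ a₂ s₂ →
         (e :- a₀ :* w₀ :* s₀ :- r) :+ w₂ :* (s₀ :- a₂ :* s₂)
         := (e :+ (w₂ :- a₀ :* w₀) :* s₀) :- r :- a₂ :* w₂ :* s₂)
         refl e a₀ (w N) s₀ r (w (2 ℕ.+ N)) a₂ s₂ ⟩
  (e + D²-coeff w N * s₀) - r - a₂ * w (2 ℕ.+ N) * s₂
    ≡⟨ cong (λ x → x - r - a₂ * w (2 ℕ.+ N) * s₂) (∑<-last (λ m → D²-coeff w m * sinPow m n) N) ⟨
  expand (D²-coeff w) (suc N) n - r - a₂ * w (2 ℕ.+ N) * s₂ ∎
  where
  open ≡-Reasoning
  e = expand (D²-coeff w) N n
  a₀ = fromℕ N * fromℕ N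
  a₂ = fromℕ (2 ℕ.+ N) * fromℕ (2 ℕ.+ N)
  s₀ = sinPow N n
  s₂ = sinPow (2 ℕ.+ N) n
  r = fromℕ (suc N) * fromℕ (suc N) * w (suc N) * sinPow (suc N) n

sinSeries-D² : ∀ w n → sinSeries w (suc (suc n)) ≡ sinSeries (D²-coeff w) n
sinSeries-D² w n = begin
  expand w (3 ℕ.+ n) (2 ℕ.+ n)
    ≡⟨ expand-D² w (suc n) n ⟩
  sinSeries (D²-coeff w) n - p * sinPow (suc n) n - q * sinPow (2 ℕ.+ n) n
    -- Both corrections are multiples of powers of the sine beyond the n-th, hence 0 in coefficient
    -- n.
    ≡⟨ cong₂ (λ x y → sinSeries (D²-coeff w) n - p * x - q * y)
         (sinPow-< {suc n} ℕ.≤-refl) (sinPow-< {2 ℕ.+ n} (ℕ.m<n⇒m<1+n ℕ.≤-refl)) ⟩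
  sinSeries (D²-coeff w) n - p * 0ℚ - q * 0ℚ
    ≡⟨ solve 3 (λ e p q → e :- p :* con 0ℚ :- q :* con 0ℚ := e) refl (sinSeries (D²-coeff w) n) p q ⟩
  sinSeries (D²-coeff w) n ∎
  where
  open ≡-Reasoning
  p = fromℕ (suc n) * fromℕ (suc n) * w (suc n)
  q = fromℕ (2 ℕ.+ n) * fromℕ (2 ℕ.+ n) * w (2 ℕ.+ n)

-- m! times the coefficient of s^m in (1 + arcsin s) / √(1 - s²).
c : Seq
c m = fromℕ ((m ∸ 1) !!) * fromℕ ((m ∸ 1) !!)

c-step : ∀ m → c (suc (suc m)) ≡ fromℕ (suc m) * fromℕ (suc m) * c m
c-step m = trans
  (cong (λ x → x * x) (trans (cong fromℕ (!!-suc m)) (fromℕ-* (suc m) ((m ∸ 1) !!))))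
  (solve 2 (λ a b → (a :* b) :* (a :* b) := a :* a :* (b :* b)) refl (fromℕ (suc m)) (fromℕ ((m ∸ 1) !!)))

-- `cosSeq ⋆ sinPow m` is the derivative of `sinPow (suc m)` by definition, so the formulas for
-- second derivatives apply. With `c-step`, term m ≥ 1 yields c_m s^(m-1)/(m-1)! - c_(m+2)
-- s^(m+1)/(m+1)!, and the sum telescopes to c_1 = 1 and two error terms.
D[cos⋆expand] : ∀ N n → (cosSeq ⋆ expand c (suc N)) (suc n) ≡
  1S n - c (suc N) * sinPow N n - c (suc (suc N)) * sinPow (suc N) n
D[cos⋆expand] zero n = trans
  (⋆-cong {cosSeq} (λ _ → refl) (λ i → trans (+-identityʳ (1ℚ * 1S i)) (*-identityˡ (1S i))) (suc n))
  (trans (sinPow-D²-1 n)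
    (solve 2 (λ s t → :- t := s :- con 1ℚ :* s :- con 1ℚ :* t) refl (1S n) (sinPow 1 n)))
D[cos⋆expand] (suc N) n = begin
  (cosSeq ⋆ expand c (2 ℕ.+ N)) (suc n)
    ≡⟨ ⋆-cong {cosSeq} (λ _ → refl) (λ i → ∑<-last (λ m → c m * sinPow m i) (suc N)) (suc n) ⟩
  (cosSeq ⋆ (λ i → expand c (suc N) i + c (suc N) * sinPow (suc N) i)) (suc n)
    ≡⟨ ⋆-distribˡ cosSeq (expand c (suc N)) _ (suc n) ⟩
  (cosSeq ⋆ expand c (suc N)) (suc n) + (cosSeq ⋆ (λ i → c (suc N) * sinPow (suc N) i)) (suc n)
    ≡⟨ cong₂ _+_ (D[cos⋆expand] N n)
         (trans (⋆-scaleʳ cosSeq (c (suc N)) (sinPow (suc N)) (suc n))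
                (cong (c (suc N) *_) (sinPow-D² N n))) ⟩
  (1S n - c (suc N) * s₀ - t) + c (suc N) * (s₀ - k * s₂)
    ≡⟨ solve 6 (λ o c₁ s₀ t k s₂ → (o :- c₁ :* s₀ :- t) :+ c₁ :* (s₀ :- k :* s₂)
         := o :- t :- k :* c₁ :* s₂) refl (1S n) (c (suc N)) s₀ t k s₂ ⟩
  1S n - t - k * c (suc N) * s₂
    ≡⟨ cong (λ x → 1S n - t - x * s₂) (c-step (suc N)) ⟨
  1S n - t - c (3 ℕ.+ N) * s₂ ∎
  where
  open ≡-Reasoning
  k = fromℕ (2 ℕ.+ N) * fromℕ (2 ℕ.+ N)
  s₀ = sinPow N n
  s₂ = sinPow (2 ℕ.+ N) n
  t = c (2 ℕ.+ N) * sinPow (suc N) n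

1S-suc : ∀ n → 1+X (suc n) ≡ 1S n
1S-suc zero    = refl
1S-suc (suc n) = refl

cos⋆expand : ∀ N {j} → j ℕ.≤ N → (cosSeq ⋆ expand c (suc N)) j ≡ 1+X j
cos⋆expand N {zero}  _   = trans (*-identityˡ (expand c (suc N) 0)) (expand≡sinSeries c (suc N) (s≤s z≤n))
cos⋆expand N {suc n} n<N = begin
  (cosSeq ⋆ expand c (suc N)) (suc n)
    ≡⟨ D[cos⋆expand] N n ⟩
  1S n - p * sinPow N n - q * sinPow (suc N) n
    ≡⟨ cong₂ (λ x y → 1S n - p * x - q * y) (sinPow-< n<N) (sinPow-< {suc N} (ℕ.m<n⇒m<1+n n<N)) ⟩
  1S n - p * 0ℚ - q * 0ℚ
    ≡⟨ solve 3 (λ e p q → e :- p :* con 0ℚ :- q :* con 0ℚ := e) refl (1S n) p q ⟩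
  1S n
    ≡⟨ 1S-suc n ⟨
  1+X (suc n) ∎
  where
  open ≡-Reasoning
  p = c (suc N)
  q = c (suc (suc N))

-- Finite differences and Newton's formula

Δ : Seq → Seq
Δ p m = p (suc m) - p m

Δ^ : ℕ → Seq → Seq
Δ^ zero    p = p
Δ^ (suc k) p = Δ^ k (Δ p)

-- p is a polynomial of degree ≤ d with d-th difference s, that is, with
-- coefficient s / d! at m^d.
data HasDegree : ℕ → ℚ → Seq → Set where
  constant   : ∀ {s p} → (∀ m → p m ≡ s) → HasDegree 0 s p
  difference : ∀ {d s p} → HasDegree d s (Δ p) → HasDegree (suc d) s p

HasDegree-cong : ∀ {d s t p q} → s ≡ t → p ≗ q → HasDegree d s p → HasDegree d t q
HasDegree-cong s≡t p≗q (constant hp)   = constant λ m → trans (sym (p≗q m)) (trans (hp m) s≡t)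
HasDegree-cong s≡t p≗q (difference hp) =
  difference (HasDegree-cong s≡t (λ m → cong₂ _-_ (p≗q (suc m)) (p≗q m)) hp)

HasDegree-+ : ∀ {d s t p q} → HasDegree d s p → HasDegree d t q →
              HasDegree d (s + t) (λ m → p m + q m)
HasDegree-+ (constant hp) (constant hq) = constant λ m → cong₂ _+_ (hp m) (hq m)
HasDegree-+ {p = p} {q} (difference hp) (difference hq) = difference (HasDegree-cong refl
  (λ m → solve 4 (λ a b c e → (a :- b) :+ (c :- e) := (a :+ c) :- (b :+ e)) refl
           (p (suc m)) (p m) (q (suc m)) (q m))
  (HasDegree-+ hp hq))

HasDegree-scale : ∀ {d} r {s p} → HasDegree d s p → HasDegree d (r * s) (λ m → r * p m)
HasDegree-scale r (constant hp) = constant λ m → cong (r *_) (hp m)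
HasDegree-scale r {p = p} (difference hp) = difference (HasDegree-cong refl
  (λ m → solve 3 (λ r a b → r :* (a :- b) := r :* a :- r :* b) refl r (p (suc m)) (p m))
  (HasDegree-scale r hp))

HasDegree-shift : ∀ {d s p} → HasDegree d s p → HasDegree d s (p ∘ suc)
HasDegree-shift (constant hp)   = constant (hp ∘ suc)
HasDegree-shift (difference hp) = difference (HasDegree-shift hp)

-- Discrete Leibniz rule: Δ(q p)(m) = Δq(m) p(m+1) + q(m) Δp(m). The first summand contributes r s
-- to the top difference, the second d r s by induction.
HasDegree-linear-* : ∀ {d r s q p} → HasDegree 1 r q → HasDegree d s p →
                     HasDegree (suc d) (fromℕ (suc d) * r * s) (λ m → q m * p m)
HasDegree-linear-* {_} {r} {s} {q} {p} (difference (constant hq)) (constant hp) =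
  difference (constant λ m → begin
  q (suc m) * p (suc m) - q m * p m   ≡⟨ cong₂ (λ x y → q (suc m) * x - q m * y) (hp (suc m)) (hp m) ⟩
  q (suc m) * s - q m * s             ≡⟨ solve 3 (λ a b s → a :* s :- b :* s := con 1ℚ :* (a :- b) :* s) refl (q (suc m)) (q m) s ⟩
  1ℚ * (q (suc m) - q m) * s          ≡⟨ cong (λ x → 1ℚ * x * s) (hq m) ⟩
  1ℚ * r * s                          ∎)
  where open ≡-Reasoning
HasDegree-linear-* {suc d} {r} {s} {q} {p} Hq@(difference (constant hq)) Hp@(difference hp) =
  difference (HasDegree-cong
  (trans (solve 3 (λ k r s → r :* s :+ k :* r :* s := (con 1ℚ :+ k) :* r :* s) refl (fromℕ (suc d)) r s)
         (cong (λ x → x * r * s) (sym (fromℕ-suc (suc d)))))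
  (λ m → trans
    (cong (λ x → x * p (suc m) + q m * (p (suc m) - p m)) (sym (hq m)))
    (solve 4 (λ a b x y → (a :- b) :* x :+ b :* (x :- y) := a :* x :- b :* y) refl
       (q (suc m)) (q m) (p (suc m)) (p m)))
  (HasDegree-+ (HasDegree-scale r (HasDegree-shift Hp)) (HasDegree-linear-* Hq hp)))

Δ^-zero : ∀ k p → (∀ m → p m ≡ 0ℚ) → Δ^ k p 0 ≡ 0ℚ
Δ^-zero zero    p p≡0 = p≡0 0
Δ^-zero (suc k) p p≡0 = Δ^-zero k (Δ p) λ m → cong₂ _-_ (p≡0 (suc m)) (p≡0 m)

HasDegree⇒Δ^-leading : ∀ {d s p} → HasDegree d s p → Δ^ d p 0 ≡ s
HasDegree⇒Δ^-leading (constant hp)   = hp 0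
HasDegree⇒Δ^-leading (difference hp) = HasDegree⇒Δ^-leading hp

HasDegree⇒Δ^-zero : ∀ {d s p k} → HasDegree d s p → d ℕ.< k → Δ^ k p 0 ≡ 0ℚ
HasDegree⇒Δ^-zero {s = s} {p} {suc k} (constant hp) _ = Δ^-zero k (Δ p) λ m →
  trans (cong₂ _-_ (hp (suc m)) (hp m)) (+-inverseʳ s)
HasDegree⇒Δ^-zero (difference hp) (s≤s d<k) = HasDegree⇒Δ^-zero hp d<k

-- Since p(m+1) = p(m) + Δp(m), Pascal's rule drives the induction on m. Any N > m serves, the
-- binomials beyond m being 0, so that N can be the size of the matrix for all entries at once.
newton : ∀ m N p → m ℕ.< N → p m ≡ ∑< (λ k → fromℕ (m C k) * Δ^ k p 0) N
newton zero (suc N) p _ = sym (begin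
  1ℚ * p 0 + ∑< (λ k → fromℕ (0 C suc k) * Δ^ k (Δ p) 0) N
    ≡⟨ cong (1ℚ * p 0 +_) (∑<-zero N λ {k} _ → *-zeroˡ (Δ^ k (Δ p) 0)) ⟩
  1ℚ * p 0 + 0ℚ
    ≡⟨ solve 1 (λ x → con 1ℚ :* x :+ con 0ℚ := x) refl (p 0) ⟩
  p 0 ∎)
  where open ≡-Reasoning
newton (suc m) (suc N) p (s≤s m<N) = begin
  p (suc m)
    ≡⟨ solve 2 (λ x y → x := y :+ (x :- y)) refl (p (suc m)) (p m) ⟩
  p m + Δ p m
    ≡⟨ cong₂ _+_ (newton m (suc N) p (ℕ.m<n⇒m<1+n m<N)) (newton m N (Δ p) m<N) ⟩
  (1ℚ * p 0 + ∑< h N) + ∑< g N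
    ≡⟨ solve 3 (λ x y z → (x :+ y) :+ z := x :+ (z :+ y)) refl (1ℚ * p 0) (∑< h N) (∑< g N) ⟩
  1ℚ * p 0 + (∑< g N + ∑< h N)
    ≡⟨ cong (1ℚ * p 0 +_) (∑-distrib-+ {N} (g ∘ toℕ) (h ∘ toℕ)) ⟨
  1ℚ * p 0 + ∑< (λ k → g k + h k) N
    ≡⟨ cong (1ℚ * p 0 +_) (∑<-cong N λ {k} _ → pascal k) ⟩
  1ℚ * p 0 + ∑< (λ k → fromℕ (suc m C suc k) * Δ^ k (Δ p) 0) N ∎
  where
  open ≡-Reasoning
  g h : Seq
  g k = fromℕ (m C k) * Δ^ k (Δ p) 0
  h k = fromℕ (m C suc k) * Δ^ k (Δ p) 0
  pascal : ∀ k → g k + h k ≡ fromℕ (suc m C suc k) * Δ^ k (Δ p) 0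
  pascal k = trans (sym (*-distribʳ-+ (Δ^ k (Δ p) 0) (fromℕ (m C k)) (fromℕ (m C suc k))))
    (cong (_* Δ^ k (Δ p) 0)
      (trans (sym (fromℕ-+ (m C k) (m C suc k))) (cong fromℕ (nCk+nC[k+1]≡[n+1]C[k+1] m k))))

-- The polynomials produced by repeated second derivatives

D²-step : Seq → Seq
D²-step p m = fromℕ (suc m) * fromℕ (suc m) * p (suc (suc m)) - fromℕ m * fromℕ m * p m

D²-poly : ℕ → Seq
D²-poly zero    m = 1ℚ
D²-poly (suc i)   = D²-step (D²-poly i)

D²-coeff-c : ∀ p → D²-coeff (λ m → c m * p m) ≗ λ m → c m * D²-step p m
D²-coeff-c p m = trans
  (cong (λ x → x * p (2 ℕ.+ m) - fromℕ m * fromℕ m * (c m * p m)) (c-step m))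
  (solve 5 (λ a b c p q → a :* c :* q :- b :* (c :* p) := c :* (a :* q :- b :* p)) refl
    (fromℕ (suc m) * fromℕ (suc m)) (fromℕ m * fromℕ m) (c m) (p m) (p (2 ℕ.+ m)))

sinSeries-cong : ∀ {w v} → w ≗ v → sinSeries w ≗ sinSeries v
sinSeries-cong w≗v n = ∑<-cong (suc n) λ {k} _ → cong (_* sinPow k n) (w≗v k)

sinSeries-D²ⁱ : ∀ i j → sinSeries c (2 ℕ.* i ℕ.+ j) ≡ sinSeries (λ m → c m * D²-poly i m) j
sinSeries-D²ⁱ zero    j = sinSeries-cong (λ m → sym (*-identityʳ (c m))) j
sinSeries-D²ⁱ (suc i) j = begin
  sinSeries c (2 ℕ.* suc i ℕ.+ j)
    ≡⟨ cong (sinSeries c) (2*suc[m]+n≡2*m+[2+n] i j) ⟩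
  sinSeries c (2 ℕ.* i ℕ.+ (2 ℕ.+ j))
    ≡⟨ sinSeries-D²ⁱ i (2 ℕ.+ j) ⟩
  sinSeries (λ m → c m * D²-poly i m) (2 ℕ.+ j)
    ≡⟨ sinSeries-D² (λ m → c m * D²-poly i m) j ⟩
  sinSeries (D²-coeff (λ m → c m * D²-poly i m)) j
    ≡⟨ sinSeries-cong (D²-coeff-c (D²-poly i)) j ⟩
  sinSeries (λ m → c m * D²-poly (suc i) m) j ∎
  where open ≡-Reasoning

2ℚ : ℚ
2ℚ = fromℕ 2

-- Rewriting the step as (2m+1) p(m) + (m+1)² (Δp(m) + Δp(m+1)) shows that the squares cancel at top
-- order and the degree rises by one only. The top differences add up to 2(d+1) s + 2d(d+1) s =
-- 2(d+1)² s.
HasDegree-D²-step : ∀ {d s p} → HasDegree d s p →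
              HasDegree (suc d) (2ℚ * fromℕ (suc d) * fromℕ (suc d) * s) (D²-step p)
HasDegree-D²-step {d} {s} {p} hp =
  HasDegree-cong (leading d) step≡ (HasDegree-+ (HasDegree-linear-* hu hp) (ve hp))
  where
  u v e : Seq
  u m = fromℕ (suc m) + fromℕ m
  v m = fromℕ (suc m)
  e m = fromℕ (suc m) * (Δ p m + Δ p (suc m))
  hv : HasDegree 1 1ℚ v
  hv = difference (constant λ m → trans (cong (_- fromℕ (suc m)) (fromℕ-suc (suc m)))
    (solve 1 (λ x → (con 1ℚ :+ x) :- x := con 1ℚ) refl (fromℕ (suc m))))
  hu : HasDegree 1 2ℚ u
  hu = difference (constant λ m → trans
    (cong₂ (λ x y → (x + y) - (y + fromℕ m))
       (trans (fromℕ-suc (suc m)) (cong (1ℚ +_) (fromℕ-suc m))) (fromℕ-suc m))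
    (solve 1 (λ x → ((con 1ℚ :+ (con 1ℚ :+ x)) :+ (con 1ℚ :+ x)) :- ((con 1ℚ :+ x) :+ x) := con 2ℚ) refl (fromℕ m)))
  step≡ : ∀ m → u m * p m + v m * e m ≡ D²-step p m
  step≡ m = trans (cong (λ k → (k + fromℕ m) * p m + k * (k * (Δ p m + Δ p (suc m)))) (fromℕ-suc m))
    (trans (solve 4 (λ k p₀ p₁ p₂ →
        ((con 1ℚ :+ k) :+ k) :* p₀ :+ (con 1ℚ :+ k) :* ((con 1ℚ :+ k) :* ((p₁ :- p₀) :+ (p₂ :- p₁)))
        := (con 1ℚ :+ k) :* (con 1ℚ :+ k) :* p₂ :- k :* k :* p₀)
        refl (fromℕ m) (p m) (p (suc m)) (p (2 ℕ.+ m)))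
      (cong (λ k → k * k * p (2 ℕ.+ m) - fromℕ m * fromℕ m * p m) (sym (fromℕ-suc m))))
  -- Top difference 2d(d+1) s of the second summand; in degree 0 that summand vanishes because Δ p
  -- does.
  t : ℕ → ℚ
  t zero    = 0ℚ
  t (suc d) = fromℕ (2 ℕ.+ d) * 1ℚ * (fromℕ (suc d) * 1ℚ * (s + s))
  ve : ∀ {d} → HasDegree d s p → HasDegree (suc d) (t d) (λ m → v m * e m)
  ve (constant hp) = difference (constant λ m → cong₂ _-_ (v*e≡0 (suc m)) (v*e≡0 m))
    where
    v*e≡0 : ∀ m → v m * e m ≡ 0ℚ
    v*e≡0 m = trans
      (cong₂ (λ x y → v m * (v m * (x + y))) (Δp≡0 m) (Δp≡0 (suc m)))
      (solve 1 (λ v → v :* (v :* con 0ℚ) := con 0ℚ) refl (v m))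
      where
      Δp≡0 : ∀ m → Δ p m ≡ 0ℚ
      Δp≡0 m = trans (cong₂ _-_ (hp (suc m)) (hp m)) (+-inverseʳ s)
  ve (difference hp) = HasDegree-linear-* hv (HasDegree-linear-* hv
    (HasDegree-+ hp (HasDegree-shift hp)))
  leading : ∀ d → fromℕ (suc d) * 2ℚ * s + t d ≡ 2ℚ * fromℕ (suc d) * fromℕ (suc d) * s
  leading zero    = solve 1 (λ s → con 1ℚ :* con 2ℚ :* s :+ con 0ℚ := con 2ℚ :* con 1ℚ :* con 1ℚ :* s) refl s
  leading (suc d) = trans
    (cong (λ x → x * 2ℚ * s + x * 1ℚ * (fromℕ (suc d) * 1ℚ * (s + s))) (fromℕ-suc (suc d)))
    (trans (solve 2 (λ k s → (con 1ℚ :+ k) :* con 2ℚ :* s :+ (con 1ℚ :+ k) :* con 1ℚ :* (k :* con 1ℚ :* (s :+ s))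
              := con 2ℚ :* (con 1ℚ :+ k) :* (con 1ℚ :+ k) :* s) refl (fromℕ (suc d)) s)
           (cong (λ x → 2ℚ * x * x * s) (sym (fromℕ-suc (suc d)))))

HasDegree-D²-poly : ∀ i → HasDegree i (fromℕ (2 ^ i ℕ.* (i ! ℕ.* i !))) (D²-poly i)
HasDegree-D²-poly zero    = constant λ _ → refl
HasDegree-D²-poly (suc i) = HasDegree-cong
  (begin
    2ℚ * fromℕ (suc i) * fromℕ (suc i) * fromℕ x
      ≡⟨ cong (λ y → y * fromℕ (suc i) * fromℕ x) (fromℕ-* 2 (suc i)) ⟨
    fromℕ (2 ℕ.* suc i) * fromℕ (suc i) * fromℕ x
      ≡⟨ cong (_* fromℕ x) (fromℕ-* (2 ℕ.* suc i) (suc i)) ⟨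
    fromℕ (2 ℕ.* suc i ℕ.* suc i) * fromℕ x
      ≡⟨ fromℕ-* (2 ℕ.* suc i ℕ.* suc i) x ⟨
    fromℕ (2 ℕ.* suc i ℕ.* suc i ℕ.* x)
      ≡⟨ cong fromℕ (2*k*k*[p*[y*y]]≡2*p*[k*y*[k*y]] (suc i) (2 ^ i) (i !)) ⟩
    fromℕ (2 ^ suc i ℕ.* (suc i ! ℕ.* suc i !)) ∎)
  (λ _ → refl) (HasDegree-D²-step (HasDegree-D²-poly i))
  where
  open ≡-Reasoning
  x = 2 ^ i ℕ.* (i ! ℕ.* i !)

-- The triangular factors

lower : ℕ → ℕ → ℚ
lower i k = Δ^ k (D²-poly i) 0

-- Row k of U is the series s^k g^(k)(s) / k! at s = sin x, where g(s) = Σ c_m s^m / m!.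
upper : ℕ → ℕ → ℚ
upper k j = sinSeries (λ m → c m * fromℕ (m C k)) j

upper-< : ∀ {k j} → j ℕ.< k → upper k j ≡ 0ℚ
upper-< {k} {j} j<k = ∑<-zero (suc j) λ {m} m≤j → trans
  (cong (λ b → c m * fromℕ b * sinPow m j) (k>n⇒nCk≡0 (ℕ.≤-<-trans (ℕ.≤-pred m≤j) j<k)))
  (solve 2 (λ c s → c :* con 0ℚ :* s := con 0ℚ) refl (c m) (sinPow m j))

upper-diag : ∀ k → upper k k ≡ c k
upper-diag k = begin
  upper k k
    ≡⟨ ∑<-last (λ m → c m * fromℕ (m C k) * sinPow m k) k ⟩
  ∑< (λ m → c m * fromℕ (m C k) * sinPow m k) k + c k * fromℕ (k C k) * sinPow k k
    ≡⟨ cong₂ _+_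
         (∑<-zero k λ {m} m<k → trans
           (cong (λ b → c m * fromℕ b * sinPow m k) (k>n⇒nCk≡0 m<k))
           (solve 2 (λ c s → c :* con 0ℚ :* s := con 0ℚ) refl (c m) (sinPow m k)))
         (cong₂ (λ b s → c k * fromℕ b * s) (nCn≡1 k) (sinPow-diag k)) ⟩
  0ℚ + c k * 1ℚ * 1ℚ
    ≡⟨ solve 1 (λ c → con 0ℚ :+ c :* con 1ℚ :* con 1ℚ := c) refl (c k) ⟩
  c k ∎
  where open ≡-Reasoning

-- Only m ≤ j < n enters coefficient j, so n terms of Newton's formula suffice and both factors are
-- square of size n.
sinSeries-newton : ∀ n p {j} → j ℕ.< n →
  sinSeries (λ m → c m * p m) j ≡ ∑[ k < n ] (Δ^ (toℕ k) p 0 * upper (toℕ k) j)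
sinSeries-newton n p {j} j<n = begin
  ∑< (λ m → c m * p m * sinPow m j) (suc j)
    ≡⟨ ∑<-cong (suc j) (λ {m} m≤j → trans
         (cong (λ x → c m * x * sinPow m j) (newton m n p (ℕ.≤-<-trans (ℕ.≤-pred m≤j) j<n)))
         (distribute m)) ⟩
  ∑[ m < suc j ] ∑[ k < n ] (δ (toℕ k) * (c (toℕ m) * b (toℕ m) (toℕ k) * sinPow (toℕ m) j))
    ≡⟨ ∑-comm {suc j} {n} (λ m k → δ (toℕ k) * (c (toℕ m) * b (toℕ m) (toℕ k) * sinPow (toℕ m) j)) ⟩
  ∑[ k < n ] ∑[ m < suc j ] (δ (toℕ k) * (c (toℕ m) * b (toℕ m) (toℕ k) * sinPow (toℕ m) j))
    ≡⟨ sum-cong-≗ {n} (λ k → *-distribˡ-sum {suc j} (δ (toℕ k))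
         (λ m → c (toℕ m) * b (toℕ m) (toℕ k) * sinPow (toℕ m) j)) ⟨
  ∑[ k < n ] (δ (toℕ k) * upper (toℕ k) j) ∎
  where
  open ≡-Reasoning
  δ : ℕ → ℚ
  δ k = Δ^ k p 0
  b : ℕ → ℕ → ℚ
  b m k = fromℕ (m C k)
  distribute : ∀ m → c m * ∑< (λ k → b m k * δ k) n * sinPow m j ≡
                     ∑[ k < n ] (δ (toℕ k) * (c m * b m (toℕ k) * sinPow m j))
  distribute m = begin
    c m * ∑< (λ k → b m k * δ k) n * sinPow m j
      ≡⟨ solve 3 (λ c x s → c :* x :* s := c :* s :* x) refl (c m) (∑< (λ k → b m k * δ k) n) (sinPow m j) ⟩
    c m * sinPow m j * ∑< (λ k → b m k * δ k) n
      ≡⟨ *-distribˡ-sum {n} (c m * sinPow m j) _ ⟩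
    ∑[ k < n ] (c m * sinPow m j * (b m (toℕ k) * δ (toℕ k)))
      ≡⟨ sum-cong-≗ {n} (λ k → solve 4 (λ c s b d → c :* s :* (b :* d) := d :* (c :* b :* s)) refl
           (c m) (sinPow m j) (b m (toℕ k)) (δ (toℕ k))) ⟩
    ∑[ k < n ] (δ (toℕ k) * (c m * b m (toℕ k) * sinPow m j)) ∎

det-sinSeries : ∀ n → det n (λ i j → sinSeries c (2 ℕ.* toℕ i ℕ.+ toℕ j)) ≡
                prod (λ k → fromℕ (2 ^ k ℕ.* (k ! ℕ.* k !)) * c k) n
det-sinSeries n = begin
  det n (λ i j → sinSeries c (2 ℕ.* toℕ i ℕ.+ toℕ j))
    ≡⟨ det-cong n (λ i j → trans
         (sinSeries-D²ⁱ (toℕ i) (toℕ j))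
         (sinSeries-newton n (D²-poly (toℕ i)) (Fin.toℕ<n j))) ⟩
  det n (λ i j → ∑[ k < n ] (lower (toℕ i) (toℕ k) * upper (toℕ k) (toℕ j)))
    ≡⟨ det-LU n lower upper (λ {i} → HasDegree⇒Δ^-zero (HasDegree-D²-poly i)) upper-< ⟩
  prod (λ k → lower k k * upper k k) n
    ≡⟨ prod-cong n (λ k → cong₂ _*_ (HasDegree⇒Δ^-leading (HasDegree-D²-poly k)) (upper-diag k)) ⟩
  prod (λ k → fromℕ (2 ^ k ℕ.* (k ! ℕ.* k !)) * c k) n ∎
  where
  open ≡-Reasoning
  prod-cong : ∀ {g h} n → g ≗ h → prod g n ≡ prod h n
  prod-cong zero    g≗h = refl
  prod-cong (suc n) g≗h = cong₂ _*_ (prod-cong n g≗h) (g≗h n)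

-- The coefficients of f

derivative : FPS → FPS
derivative g n = fromℕ (suc n) * g (suc n)

egfCoeff-derivative : ∀ g n → egfCoeff (derivative g) n ≡ egfCoeff g (suc n)
egfCoeff-derivative g n = trans
  (solve 3 (λ a b x → a :* (b :* x) := b :* a :* x) refl (fromℕ (n !)) (fromℕ (suc n)) (g (suc n)))
  (cong (_* g (suc n)) (sym (fromℕ-* (suc n) (n !))))

-- Each product p_i q_{n+1-i} is weighted by n + 1 = i + (n + 1 - i).
⊛-leibniz : ∀ p q n → derivative (p ⊛ q) n ≡ (derivative p ⊛ q) n + (p ⊛ derivative q) n
⊛-leibniz p q n = begin
  fromℕ (suc n) * ∑< t (2 ℕ.+ n)
    ≡⟨ *-distribˡ-sum {2 ℕ.+ n} (fromℕ (suc n)) (t ∘ toℕ) ⟩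
  ∑< (λ i → fromℕ (suc n) * t i) (2 ℕ.+ n)
    ≡⟨ ∑<-cong {h = λ i → x i + y i} (2 ℕ.+ n) (λ i≤1+n → split (ℕ.≤-pred i≤1+n)) ⟩
  ∑< (λ i → x i + y i) (2 ℕ.+ n)
    ≡⟨ ∑-distrib-+ {2 ℕ.+ n} (x ∘ toℕ) (y ∘ toℕ) ⟩
  ∑< x (2 ℕ.+ n) + ∑< y (2 ℕ.+ n)
    ≡⟨ cong₂ _+_ first second ⟩
  (derivative p ⊛ q) n + (p ⊛ derivative q) n ∎
  where
  open ≡-Reasoning
  t x y : ℕ → ℚ
  t i = p i * q (suc n ∸ i)
  x i = fromℕ i * p i * q (suc n ∸ i)
  y i = p i * (fromℕ (suc n ∸ i) * q (suc n ∸ i))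
  split : ∀ {i} → i ℕ.≤ suc n → fromℕ (suc n) * t i ≡ x i + y i
  split {i} i≤1+n = trans
    (cong (_* t i) (trans (cong fromℕ (sym (ℕ.m+[n∸m]≡n i≤1+n))) (fromℕ-+ i (suc n ∸ i))))
    (solve 4 (λ a b p q → (a :+ b) :* (p :* q) := a :* p :* q :+ p :* (b :* q)) refl
      (fromℕ i) (fromℕ (suc n ∸ i)) (p i) (q (suc n ∸ i)))
  first : ∑< x (2 ℕ.+ n) ≡ (derivative p ⊛ q) n
  first = trans (cong (_+ ∑< (x ∘ suc) (suc n))
                  (solve 2 (λ p q → con 0ℚ :* p :* q := con 0ℚ) refl (p 0) (q (suc n))))
                (+-identityˡ _)
  second : ∑< y (2 ℕ.+ n) ≡ (p ⊛ derivative q) n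
  second = begin
    ∑< y (2 ℕ.+ n)             ≡⟨ ∑<-last y (suc n) ⟩
    ∑< y (suc n) + y (suc n)   ≡⟨ cong₂ _+_ (∑<-cong {h = λ i → p i * derivative q (n ∸ i)} (suc n) λ {i} i≤n →
                                     cong (λ m → p i * (fromℕ m * q m)) (ℕ.+-∸-assoc 1 (ℕ.≤-pred i≤n)))
                                   (trans (cong (λ m → p (suc n) * (fromℕ m * q m)) (ℕ.n∸n≡0 n))
                                     (solve 2 (λ p q → p :* (con 0ℚ :* q) := con 0ℚ) refl (p (suc n)) (q 0))) ⟩
    (p ⊛ derivative q) n + 0ℚ  ≡⟨ +-identityʳ _ ⟩
    (p ⊛ derivative q) n       ∎

-- Both products obey the Leibniz rule and `egfCoeff` turns `derivative` into `D`, so induction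
-- compares them without binomial coefficients.
egfCoeff-⊛ : ∀ p q → egfCoeff (p ⊛ q) ≗ egfCoeff p ⋆ egfCoeff q
egfCoeff-⊛ p q zero    = solve 2 (λ p q → con 1ℚ :* (p :* q :+ con 0ℚ) := con 1ℚ :* p :* (con 1ℚ :* q)) refl (p 0) (q 0)
egfCoeff-⊛ p q (suc n) = begin
  egfCoeff (p ⊛ q) (suc n)
    ≡⟨ egfCoeff-derivative (p ⊛ q) n ⟨
  fromℕ (n !) * derivative (p ⊛ q) n
    ≡⟨ cong (fromℕ (n !) *_) (⊛-leibniz p q n) ⟩
  fromℕ (n !) * ((derivative p ⊛ q) n + (p ⊛ derivative q) n)
    ≡⟨ *-distribˡ-+ (fromℕ (n !)) ((derivative p ⊛ q) n) ((p ⊛ derivative q) n) ⟩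
  egfCoeff (derivative p ⊛ q) n + egfCoeff (p ⊛ derivative q) n
    ≡⟨ cong₂ _+_
         (trans (egfCoeff-⊛ (derivative p) q n)
                (⋆-cong {h = egfCoeff q} (egfCoeff-derivative p) (λ _ → refl) n))
         (trans (egfCoeff-⊛ p (derivative q) n)
                (⋆-cong {egfCoeff p} (λ _ → refl) (egfCoeff-derivative q) n)) ⟩
  (egfCoeff p ⋆ egfCoeff q) (suc n) ∎
  where open ≡-Reasoning

egfCoeff-egf : ∀ s → egfCoeff (egf s) ≗ s
egfCoeff-egf s k = trans
  (solve 3 (λ m s r → m :* (s :* r) := s :* (m :* r)) refl (fromℕ (k !)) (s k) ((ℤ.+ 1 / (k !)) {{k ℕ.!≢0}}))
  (trans (cong (s k *_) (fromℕ-inverse (k !) {{k ℕ.!≢0}})) (*-identityʳ (s k)))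

egfCoeff-1S : egfCoeff 1S ≗ 1S
egfCoeff-1S zero    = refl
egfCoeff-1S (suc n) = *-zeroʳ (fromℕ (suc n !))

egfCoeff-1+X : egfCoeff 1+X ≗ 1+X
egfCoeff-1+X 0             = refl
egfCoeff-1+X 1             = refl
egfCoeff-1+X (suc (suc n)) = *-zeroʳ (fromℕ (suc (suc n) !))

cos⋆E : cosSeq ⋆ E ≗ 1S
cos⋆E n = begin
  (cosSeq ⋆ E) n                           ≡⟨ ⋆-cong {h = E} (egfCoeff-egf cosSeq) (λ _ → refl) n ⟨
  (egfCoeff cosine ⋆ egfCoeff secant) n    ≡⟨ egfCoeff-⊛ cosine secant n ⟨
  egfCoeff (cosine ⊛ secant) n             ≡⟨ cong (fromℕ (n !) *_) (⊛-recip cosine n) ⟩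
  egfCoeff 1S n                            ≡⟨ egfCoeff-1S n ⟩
  1S n                                     ∎
  where open ≡-Reasoning

a≗1+X⋆E : a ≗ 1+X ⋆ E
a≗1+X⋆E n = trans (egfCoeff-⊛ 1+X secant n) (⋆-cong {h = E} egfCoeff-1+X (λ _ → refl) n)

cos⋆a : cosSeq ⋆ a ≗ 1+X
cos⋆a n = begin
  (cosSeq ⋆ a) n             ≡⟨ ⋆-cong {cosSeq} (λ _ → refl) (λ i → trans (a≗1+X⋆E i) (⋆-comm 1+X E i)) n ⟩
  (cosSeq ⋆ (E ⋆ 1+X)) n     ≡⟨ ⋆-assoc cosSeq E 1+X n ⟨
  (cosSeq ⋆ E ⋆ 1+X) n       ≡⟨ ⋆-cong {h = 1+X} cos⋆E (λ _ → refl) n ⟩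
  (1S ⋆ 1+X) n               ≡⟨ ⋆-comm 1S 1+X n ⟩
  (1+X ⋆ 1S) n               ≡⟨ ⋆-identityʳ 1+X n ⟩
  1+X n                      ∎
  where open ≡-Reasoning

-- Both sides solve cos x · y = 1 + x. Truncated after s^n, the right one is only shown to solve it
-- up to coefficient n, which is all that coefficient n needs.
a≗sinSeries : a ≗ sinSeries c
a≗sinSeries n = ⋆-cancelˡ (suc n) cosSeq a (expand c (suc n)) refl
  (λ {j} j≤n → trans (cos⋆a j) (sym (cos⋆expand n (ℕ.≤-pred j≤n)))) ℕ.≤-refl

-- `D 1+X` is `1S`, so at most one of the n + 1 differentiations can fall on 1 + x; the choice of
-- which one gives n + 1 copies of `g n`.
1+X⋆-suc : ∀ g n → (1+X ⋆ g) (suc n) ≡ g (suc n) + fromℕ (suc n) * g n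
1+X⋆-suc g n = trans
  (cong (_+ (1+X ⋆ D g) n) (trans (⋆-cong {h = g} 1S-suc (λ _ → refl) n)
    (trans (⋆-comm 1S g n) (⋆-identityʳ g n))))
  (rest n)
  where
  rest : ∀ n → g n + (1+X ⋆ D g) n ≡ g (suc n) + fromℕ (suc n) * g n
  rest zero    = solve 2 (λ x y → x :+ con 1ℚ :* y := y :+ con 1ℚ :* x) refl (g 0) (g 1)
  rest (suc n) = trans (cong (g (suc n) +_) (1+X⋆-suc (D g) n))
    (trans (solve 3 (λ x y k → x :+ (y :+ k :* x) := y :+ (con 1ℚ :+ k) :* x) refl
             (g (suc n)) (g (2 ℕ.+ n)) (fromℕ (suc n)))
           (cong (λ k → g (2 ℕ.+ n) + k * g (suc n)) (sym (fromℕ-suc (suc n)))))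

evens-odd : ∀ s k → evens s (suc (2 ℕ.* k)) ≡ 0ℚ
evens-odd s zero    = refl
evens-odd s (suc k) rewrite ℕ.+-suc k (k ℕ.+ 0) = evens-odd (s ∘ suc) k

E-odd : ∀ k → E (suc (2 ℕ.* k)) ≡ 0ℚ
E-odd k = begin
  E n                            ≡⟨ cong (fromℕ (n !) *_) (secant≗ n) ⟩
  egfCoeff (egf (evens (λ k → E (2 ℕ.* k)))) n
                                 ≡⟨ egfCoeff-egf (evens (λ k → E (2 ℕ.* k))) n ⟩
  evens (λ k → E (2 ℕ.* k)) n    ≡⟨ evens-odd (λ k → E (2 ℕ.* k)) k ⟩
  0ℚ                             ∎
  where
  open ≡-Reasoning
  n = suc (2 ℕ.* k)

a-even : ∀ k → a (2 ℕ.* k) ≡ E (2 ℕ.* k)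
a-even zero    = refl
a-even (suc k) = begin
  a (2 ℕ.* suc k)                        ≡⟨ cong a (ℕ.*-suc 2 k) ⟩
  a (2 ℕ.+ 2 ℕ.* k)                      ≡⟨ a≗1+X⋆E (2 ℕ.+ 2 ℕ.* k) ⟩
  (1+X ⋆ E) (2 ℕ.+ 2 ℕ.* k)              ≡⟨ 1+X⋆-suc E (suc (2 ℕ.* k)) ⟩
  E (2 ℕ.+ 2 ℕ.* k) + r * E (suc (2 ℕ.* k))
                                         ≡⟨ cong (λ x → E (2 ℕ.+ 2 ℕ.* k) + r * x) (E-odd k) ⟩
  E (2 ℕ.+ 2 ℕ.* k) + r * 0ℚ             ≡⟨ solve 2 (λ x r → x :+ r :* con 0ℚ := x) refl (E (2 ℕ.+ 2 ℕ.* k)) r ⟩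
  E (2 ℕ.+ 2 ℕ.* k)                      ≡⟨ cong E (ℕ.*-suc 2 k) ⟨
  E (2 ℕ.* suc k)                        ∎
  where
  open ≡-Reasoning
  r = fromℕ (2 ℕ.+ 2 ℕ.* k)

a-odd : ∀ k → a (2 ℕ.* k ℕ.+ 1) ≡ fromℕ (2 ℕ.* k ℕ.+ 1) * E (2 ℕ.* k)
a-odd k rewrite ℕ.+-comm (2 ℕ.* k) 1 = begin
  a (suc (2 ℕ.* k))                              ≡⟨ a≗1+X⋆E (suc (2 ℕ.* k)) ⟩
  (1+X ⋆ E) (suc (2 ℕ.* k))                      ≡⟨ 1+X⋆-suc E (2 ℕ.* k) ⟩
  E (suc (2 ℕ.* k)) + r * E (2 ℕ.* k)            ≡⟨ cong (_+ r * E (2 ℕ.* k)) (E-odd k) ⟩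
  0ℚ + r * E (2 ℕ.* k)                           ≡⟨ +-identityˡ _ ⟩
  r * E (2 ℕ.* k)                                ∎
  where
  open ≡-Reasoning
  r = fromℕ (suc (2 ℕ.* k))

-- The product of the pivots and the theorem

prod-closed-form : ∀ m →
  prod (λ k → fromℕ (2 ^ k ℕ.* (k ! ℕ.* k !)) * c k) (suc m) ≡
  fromℕ (2 ^ (suc m C 2) ℕ.* (m !!) ^ 2 ℕ.* ∏₁ (m ∸ 1) (λ k → (k !!) ^ 6))
-- This is n = 1: the product over k from 1 to -1 is empty because `m ∸ 1` truncates to 0.
prod-closed-form zero    = refl
prod-closed-form (suc m) = begin
  prod h (suc m) * (fromℕ y * (fromℕ (m !!) * fromℕ (m !!)))
    ≡⟨ cong₂ (λ p q → p * (fromℕ y * q)) (prod-closed-form m) (sym (fromℕ-* (m !!) (m !!))) ⟩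
  fromℕ x * (fromℕ y * fromℕ (m !! ℕ.* m !!))
    ≡⟨ cong (fromℕ x *_) (fromℕ-* y (m !! ℕ.* m !!)) ⟨
  fromℕ x * fromℕ (y ℕ.* (m !! ℕ.* m !!))
    ≡⟨ fromℕ-* x (y ℕ.* (m !! ℕ.* m !!)) ⟨
  fromℕ (x ℕ.* (y ℕ.* (m !! ℕ.* m !!)))
    ≡⟨ cong fromℕ (closed-form-step m) ⟩
  fromℕ (2 ^ ((2 ℕ.+ m) C 2) ℕ.* (suc m !!) ^ 2 ℕ.* ∏₁ m (λ k → (k !!) ^ 6)) ∎
  where
  open ≡-Reasoning
  h : ℕ → ℚ
  h k = fromℕ (2 ^ k ℕ.* (k ! ℕ.* k !)) * c k
  x = 2 ^ (suc m C 2) ℕ.* (m !!) ^ 2 ℕ.* ∏₁ (m ∸ 1) (λ k → (k !!) ^ 6)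
  y = 2 ^ suc m ℕ.* (suc m ! ℕ.* suc m !)

hankel-closed-form : ∀ n → n ≥ 1 →
  Ḧ n f ≡ fromℕ (2 ^ (n C 2) ℕ.* ((n ∸ 1) !!) ^ 2 ℕ.* ∏₁ (n ∸ 2) (λ k → (k !!) ^ 6))
hankel-closed-form (suc m) _ = trans
  (det-cong (suc m) λ i j → a≗sinSeries (2 ℕ.* toℕ i ℕ.+ toℕ j))
  (trans (det-sinSeries (suc m)) (prod-closed-form m))

proposition11p1 : (∀ k → a (2 ℕ.* k) ≡ E (2 ℕ.* k)) ×
    (∀ k → a (2 ℕ.* k ℕ.+ 1) ≡ fromℕ (2 ℕ.* k ℕ.+ 1) * E (2 ℕ.* k)) ×
    (∀ n → n ≥ 1 →
    Ḧ n f ≡ fromℕ (2 ^ (n C 2) ℕ.* ((n ∸ 1) !!) ^ 2 ℕ.* ∏₁ (n ∸ 2) (λ k → (k !!) ^ 6)))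
proposition11p1 = a-even , a-odd , hankel-closed-form
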